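{- Let $n\ge 2$. The $n\times n$ matrix $$C_{n} = \begin{pmatrix} 3 & 7 & 15 & 31 & 63 & \cdots & 2^{n+1}-1 \\ 1 & 3 & 7 & 15 & 31 & \cdots & 2^{n}-1 \\ 0 & 1 & 3 & 7 & 15 & \cdots & 2^{n-1}-1 \\ 0 & 0 & 1 & 3 & 7 & \cdots & 2^{n-2}-1 \\ 0 & 0 & 0 & 1 & 3 & \cdots & 2^{n-3}-1 \\ \vdots & \vdots & \vdots & \vdots & \vdots & \ddots & \vdots \\ 0 & 0 & 0 & 0 & 0 & \cdots & 3 \end{pmatrix}$$ (whose $(p,q)$ entry is $2^{q-p+2}-1$ if $q\ge p-1$ and $0$ if $q<p-1$) is a production matrix for plane connected graphs of point sets in convex position; that is, $v^{i+1}=C_n v^i$ for all $i$ with $2\le i\le n$.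
   Context: A geometric graph on a finite point set $\mathcal S\subseteq\mathbb R^2$ has vertex set $\mathcal S$ and edges that are straight-line segments with endpoints in $\mathcal S$; it is plane if no two edges intersect except at common endpoints. Graphs with $i$ vertices are considered on points $p_1,\dots,p_i$ in convex position labelled in counter-clockwise order. Two vertices are visible (from each other) if the line segment connecting them does not intersect the interior of any edge of the graph. The visibility degree of the root vertex $p_i$ of a graph on $\{p_1,\dots,p_i\}$ is the number of vertices visible from an additional vertex $p_{i+1}$ inserted between $p_i$ and $p_1$ in convex position, minus $2$. For $2\le i\le n+1$, $v^i$ is the $n$-dimensional column vector whose $j$-th entry is the number of connected plane geometric graphs on $i$ points in convex position whose root vertex has visibility degree $j-1$ (so $v^2=(1,0,\dots,0)^\top$). A production matrix is a matrix satisfying $v^{i+1}=C_nv^i$. -}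

module Defs where

open import Level using (Level; _⊔_; 0ℓ) renaming (suc to lsuc)
open import Algebra.Bundles using (CommutativeRing)
open import Data.Bool using (Bool; true; false; if_then_else_)
open import Data.Fin as Fin using (Fin; toℕ; fromℕ; inject₁)
open import Data.Fin.Permutation using (↔⇒≡)
open import Data.Nat as ℕ using (ℕ; suc; _∸_; _^_; _≤ᵇ_)
open import Data.Nat.Properties using (+-0-commutativeMonoid)
open import Data.Product using (Σ; ∃; _×_; _,_; proj₁)
open import Data.Sum using (_⊎_)
open import Data.Vec.Functional using (Vector)
open import Function.Bundles using (Inverse)
import Function.Construct.Composition as Composition
import Function.Construct.Symmetry as Symmetry
open import Relation.Binary.Bundles using (Setoid)
open import Relation.Binary.Core using (Rel)
open import Relation.Binary.Structures using (IsStrictTotalOrder)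
open import Relation.Binary.Construct.Closure.ReflexiveTransitive using (Star)
import Relation.Binary.Construct.On as On
import Relation.Binary.Construct.StrictToNonStrict as ToNonStrict
open import Relation.Binary.PropositionalEquality as ≡ using (_≡_; _≗_)
open import Relation.Nullary using (¬_)

open import Algebra.Properties.CommutativeMonoid.Sum +-0-commutativeMonoid using (sum)

private
  variable
    a p c ℓ ℓ₁ ℓ₂ : Level

-- The order is a decidable linear order, as it is for ℝ in classical
-- mathematics.
record OrderedField c ℓ₁ ℓ₂ : Set (lsuc (c ⊔ ℓ₁ ⊔ ℓ₂)) where
  field
    commutativeRing : CommutativeRing c ℓ₁

  open CommutativeRing commutativeRing public

  infix 4 _<_

  field
    _<_                : Rel Carrier ℓ₂
    isStrictTotalOrder : IsStrictTotalOrder _≈_ _<_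
    0<1                : 0# < 1#
    +-monoʳ-<          : ∀ x {y z} → y < z → (x + y) < (x + z)
    *-pos              : ∀ {x y} → 0# < x → 0# < y → 0# < (x * y)
    inverse            : ∀ x → ¬ (x ≈ 0#) → ∃ λ y → (x * y) ≈ 1#

  open ToNonStrict _≈_ _<_ public using (_≤_)

-- Count S P k: up to the equality of S, exactly k elements of S satisfy P.
Count : (S : Setoid a ℓ) → (Setoid.Carrier S → Set p) → ℕ → Set (a ⊔ ℓ ⊔ p)
Count S P k = Inverse (≡.setoid (Fin k)) (On.setoid {B = ∃ P} S proj₁)

Count-unique : (S : Setoid a ℓ) (P : Setoid.Carrier S → Set p) {k l : ℕ} →
               Count S P k → Count S P l → k ≡ l
Count-unique S P f g = ↔⇒≡ (Composition.inverse f (Symmetry.inverse g))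

record Graph (m : ℕ) : Set where
  field
    adj    : Fin m → Fin m → Bool
    irrefl : ∀ u → adj u u ≡ false
    symm   : ∀ u v → adj u v ≡ adj v u

  Adj : Fin m → Fin m → Set
  Adj u v = adj u v ≡ true

open Graph public

graphSetoid : ℕ → Setoid 0ℓ 0ℓ
graphSetoid m = record
  { Carrier       = Graph m
  ; _≈_           = λ G H → ∀ u v → adj G u v ≡ adj H u v
  ; isEquivalence = record
    { refl  = λ _ _ → ≡.refl
    ; sym   = λ G≈H u v → ≡.sym (G≈H u v)
    ; trans = λ G≈H H≈K u v → ≡.trans (G≈H u v) (H≈K u v)
    }
  }

Connected : ∀ {m} → Graph m → Set
Connected G = ∀ u v → Star (Adj G) u v

module Geometry (F : OrderedField c ℓ₁ ℓ₂) where

  open OrderedField F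

  Point : Set c
  Point = Carrier × Carrier

  infix 4 _≈ₚ_

  _≈ₚ_ : Rel Point ℓ₁
  (x₁ , y₁) ≈ₚ (x₂ , y₂) = (x₁ ≈ x₂) × (y₁ ≈ y₂)

  -- The point A + t (B − A).
  along : Point → Point → Carrier → Point
  along (x₁ , y₁) (x₂ , y₂) t = (x₁ + t * (x₂ - x₁)) , (y₁ + t * (y₂ - y₁))

  OnSegment : Point → Point → Point → Set (c ⊔ ℓ₁ ⊔ ℓ₂)
  OnSegment A B Q = ∃ λ t → (0# ≤ t) × (t ≤ 1#) × (Q ≈ₚ along A B t)

  InInterior : Point → Point → Point → Set (c ⊔ ℓ₁ ⊔ ℓ₂)
  InInterior A B Q = ∃ λ t → (0# < t) × (t < 1#) × (Q ≈ₚ along A B t)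

  -- Twice the signed area of the triangle ABC; positive iff A, B, C make a
  -- left turn.
  orient : Point → Point → Point → Carrier
  orient (x₁ , y₁) (x₂ , y₂) (x₃ , y₃) =
    (x₂ - x₁) * (y₃ - y₁) - (y₂ - y₁) * (x₃ - x₁)

  -- Convex position, labelled in counter-clockwise order (m ≥ 3): every
  -- triple with increasing labels is a left turn.
  ConvexCCW : ∀ {m} → (Fin m → Point) → Set ℓ₂
  ConvexCCW pt = ∀ {u v w} → u Fin.< v → v Fin.< w →
                 0# < orient (pt u) (pt v) (pt w)

  ConvexPoints : ℕ → Set (c ⊔ ℓ₂)
  ConvexPoints m = Σ (Fin m → Point) ConvexCCW

  -- In the next two definitions pt places the vertices of the graph.

  Plane : ∀ {m} → (Fin m → Point) → Graph m → Set (c ⊔ ℓ₁ ⊔ ℓ₂)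
  Plane pt G = ∀ {u v x y} → Adj G u v → Adj G x y →
    ¬ ((u ≡ x × v ≡ y) ⊎ (u ≡ y × v ≡ x)) →
    ∀ Q → OnSegment (pt u) (pt v) Q → OnSegment (pt x) (pt y) Q →
    ∃ λ w → (w ≡ u ⊎ w ≡ v) × (w ≡ x ⊎ w ≡ y) × (Q ≈ₚ pt w)

  Visible : ∀ {m} → (Fin m → Point) → Graph m → Point → Point →
            Set (c ⊔ ℓ₁ ⊔ ℓ₂)
  Visible pt G A B = ∀ {u v} → Adj G u v →
    ∀ Q → OnSegment A B Q → ¬ InInterior (pt u) (pt v) Q

  -- From here on, of the i + 1 points given, the first i (via inject₁) carry
  -- the graph, and the last one (fromℕ i) is the additional vertex inserted
  -- between the root and the first vertex.

  VisibilityDegree : ∀ {i} → (Fin (suc i) → Point) → Graph i → ℕ →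
                     Set (c ⊔ ℓ₁ ⊔ ℓ₂)
  VisibilityDegree {i} pt G d =
    Count (≡.setoid (Fin i))
          (λ u → Visible (λ w → pt (inject₁ w)) G (pt (fromℕ i)) (pt (inject₁ u)))
          (2 ℕ.+ d)

  -- Indices are 0-based, so entry j counts the graphs of visibility degree j.
  IsDegreeVector : ∀ {i n} → ConvexPoints (suc i) → Vector ℕ n →
                   Set (c ⊔ ℓ₁ ⊔ ℓ₂)
  IsDegreeVector {i} (pt , _) v = ∀ j →
    Count (graphSetoid i)
          (λ G → Plane (λ w → pt (inject₁ w)) G × Connected G ×
                 VisibilityDegree pt G (toℕ j))
          (v j)

  IsDegreeVector-unique : ∀ {i n} (P : ConvexPoints (suc i)) {v w : Vector ℕ n} →
                          IsDegreeVector P v → IsDegreeVector P w → v ≗ w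
  IsDegreeVector-unique {i} P f g j = Count-unique (graphSetoid i) _ (f j) (g j)

Matrix : ℕ → Set
Matrix n = Fin n → Fin n → ℕ

infixr 7 _*ᵥ_

_*ᵥ_ : ∀ {n} → Matrix n → Vector ℕ n → Vector ℕ n
(M *ᵥ v) r = sum (λ q → M r q ℕ.* v q)

-- The exponent is q − r + 2, and r ≤ q + 1 makes it positive.
C : ∀ n → Matrix n
C n r q = if toℕ r ≤ᵇ suc (toℕ q)
          then 2 ^ ((toℕ q ℕ.+ 2) ∸ toℕ r) ∸ 1
          else 0

{-# OPTIONS --safe #-}

-- Cut a connected plane graph on the points l, …, r at the last vertex k of
-- the component of l in the graph without r.  What remains is a connected
-- graph on l, …, k, a connected graph on k + 1, …, r, and a nonempty set Y of
-- vertices visible in the first part, namely the neighbours of r; conversely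
-- any such triple gives a graph.  Calling the edges between consecutive
-- visible vertices arches, the graph has p + 1 arches when p is the index of
-- min Y.  Hence, for a weight f depending on the number of arches, the sum
-- total m f over all connected graphs on m + 1 points satisfies
--   total (m + 1) f = Σ_{i+j=m} total i 1 * total j (2^· ⊛ f(1 + ·)),
-- where ⊛ is convolution.  Concatenating graphs adds arches, so the right side
-- is total m (1 ⊛ 2^· ⊛ f(1 + ·)); as (1 ⊛ 2^·)(k) = 2^(k+1) − 1, taking for f
-- the indicator of p + 1 arches gives the p-th row of the matrix.
module Submission where

-- The component of l without r is an interval because the graph is plane: a vertex between l and k
-- outside the component could reach r only across its edges. So k is the first vertex such that
-- every edge leaving l, ..., k to the right ends at r. Once the number p of the smallest neighbour
-- of r is fixed, its other neighbours form an arbitrary subset of the a₁ - p later visible vertices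
-- of the first part; this is the origin of 2^·. The second part has weight 1 because the edge from
-- min Y to r hides all its arches.
--
-- The obstacle is that the first part must be shown connected without r. Connectivity is therefore
-- tested by 2-colourings that are constant along edges: these extend from a part to the whole graph
-- more easily than paths are rerouted. Coordinates enter only through the facts that labels decide
-- which edges cross and which vertices are visible, so one vector serves all point sets of the same
-- size.

open import Defs
open import Algebra.Bundles using (CommutativeRing)
import Algebra.Properties.Ring
import Algebra.Properties.Semiring.Mult.TCOptimised
import Algebra.Solver.Ring
open import Algebra.Solver.Ring.AlmostCommutativeRing using (fromCommutativeRing; _-Raw-AlmostCommutative⟶_)
open import Data.Bool using (Bool; true; false; if_then_else_; T)
import Data.Bool.Properties as Bool
open import Data.Empty using (⊥; ⊥-elim)
open import Data.Fin as Fin using (Fin; toℕ; fromℕ; fromℕ<; inject₁)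
import Data.Fin.Properties as Fin
import Data.Maybe as Maybe
open import Data.Nat as ℕ using (ℕ; zero; suc)
import Data.Nat.Properties as ℕ
open import Data.Nat.Tactic.RingSolver using (solve-∀)
open import Data.Product
open import Data.Product.Function.NonDependent.Propositional using (_×-↔_)
open import Data.Sign using (Sign)
open import Data.Sum as Sum using (_⊎_; inj₁; inj₂)
open import Data.Sum.Function.Propositional using (_⊎-↔_)
open import Data.Unit using (⊤; tt)
open import Data.Vec using (Vec; []; _∷_; tabulate)
open import Data.Vec.Functional using (Vector)
open import Function using (_∘_; case_of_; _↔_; mk↔ₛ′; Inverse)
open import Function.Properties.Inverse using (↔-trans)
open import Level using (_⊔_)
open import Relation.Binary.Bundles using (Setoid)
import Relation.Binary.Construct.On as On
open import Relation.Binary.Construct.Closure.ReflexiveTransitive using (Star; ε; _◅_; _◅◅_; reverse)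
open import Relation.Binary.Core using (Rel)
open import Relation.Binary.Definitions using (Tri; tri<; tri≈; tri>)
open import Relation.Binary.PropositionalEquality as ≡ using (_≡_; _≢_; _≗_)
import Relation.Binary.Reasoning.Setoid
open import Relation.Binary.Structures using (IsEquivalence; IsStrictTotalOrder)
open import Relation.Nullary using (¬_; Dec; yes; no; contradiction)
open import Relation.Nullary.Decidable using (does; dec-true; dec-false; dec⇒maybe; decidable-stable; map′; ¬?; _⊎-dec_; _×-dec_)

-- Convex position over an ordered field

-- With coefficients in ℤ rather than in R itself, the solver can decide that
-- coefficients cancel.
module IntegerSolver {c ℓ} (R : CommutativeRing c ℓ) where
  open CommutativeRing R
  open import Data.Integer as ℤ using (ℤ; +_; -[1+_]; _⊖_)
  import Data.Integer.Properties as ℤ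
  open Algebra.Properties.Ring ring
  open Algebra.Properties.Semiring.Mult.TCOptimised semiring renaming (_×_ to infixl 8 _·_)
  open Relation.Binary.Reasoning.Setoid setoid

  ⟦_⟧ℤ : ℤ → Carrier
  ⟦ + n ⟧ℤ      = n · 1#
  ⟦ -[1+ n ] ⟧ℤ = - (suc n · 1#)

  neg-homo : ∀ i → ⟦ ℤ.- i ⟧ℤ ≈ - ⟦ i ⟧ℤ
  neg-homo (+ zero)   = sym -0#≈0#
  neg-homo (+ suc n)  = refl
  neg-homo -[1+ n ]   = sym (-‿involutive _)

  cancel : ∀ x a b → (x + a) - (x + b) ≈ a - b
  cancel x a b = begin
    (x + a) - (x + b)          ≈⟨ +-congˡ (-‿+-comm x b) ⟨
    (x + a) + (- x - b)        ≈⟨ +-congʳ (+-comm x a) ⟩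
    (a + x) + (- x - b)        ≈⟨ +-assoc a x _ ⟩
    a + (x + (- x - b))        ≈⟨ +-congˡ (+-assoc x (- x) (- b)) ⟨
    a + (x - x - b)            ≈⟨ +-congˡ (+-congʳ (-‿inverseʳ x)) ⟩
    a + (0# - b)               ≈⟨ +-congˡ (+-identityˡ _) ⟩
    a - b                      ∎

  ⊖-homo : ∀ m n → ⟦ m ⊖ n ⟧ℤ ≈ m · 1# - n · 1#
  ⊖-homo zero    zero    = sym (-‿inverseʳ 0#)
  ⊖-homo zero    (suc n) = sym (+-identityˡ _)
  ⊖-homo (suc m) zero    = sym (trans (+-congˡ -0#≈0#) (+-identityʳ _))
  ⊖-homo (suc m) (suc n) = begin
    ⟦ suc m ⊖ suc n ⟧ℤ                ≡⟨ ≡.cong ⟦_⟧ℤ (ℤ.[1+m]⊖[1+n]≡m⊖n m n) ⟩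
    ⟦ m ⊖ n ⟧ℤ                        ≈⟨ ⊖-homo m n ⟩
    m · 1# - n · 1#                   ≈⟨ cancel 1# _ _ ⟨
    (1# + m · 1#) - (1# + n · 1#)     ≈⟨ +-cong (1+× m 1#) (-‿cong (1+× n 1#)) ⟨
    suc m · 1# - suc n · 1#           ∎

  +-homo : ∀ i j → ⟦ i ℤ.+ j ⟧ℤ ≈ ⟦ i ⟧ℤ + ⟦ j ⟧ℤ
  +-homo (+ m)    (+ n)    = ×-homo-+ 1# m n
  +-homo (+ m)    -[1+ n ] = ⊖-homo m (suc n)
  +-homo -[1+ m ] (+ n)    = trans (⊖-homo n (suc m)) (+-comm _ _)
  +-homo -[1+ m ] -[1+ n ] = begin
    - (suc (suc (m ℕ.+ n)) · 1#)      ≡⟨ ≡.cong (λ k → - (suc k · 1#)) (ℕ.+-suc m n) ⟨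
    - ((suc m ℕ.+ suc n) · 1#)        ≈⟨ -‿cong (×-homo-+ 1# (suc m) (suc n)) ⟩
    - (suc m · 1# + suc n · 1#)       ≈⟨ -‿+-comm _ _ ⟨
    - (suc m · 1#) - suc n · 1#       ∎

  *-homo : ∀ i j → ⟦ i ℤ.* j ⟧ℤ ≈ ⟦ i ⟧ℤ * ⟦ j ⟧ℤ
  *-homo (+ m)    (+ n)    = trans (reflexive (≡.cong ⟦_⟧ℤ (ℤ.+◃n≡+n (m ℕ.* n)))) (×1-homo-* m n)
  *-homo (+ m)    -[1+ n ] = begin
    ⟦ Sign.- ℤ.◃ m ℕ.* suc n ⟧ℤ       ≡⟨ ≡.cong ⟦_⟧ℤ (ℤ.-◃n≡-n (m ℕ.* suc n)) ⟩
    ⟦ ℤ.- + (m ℕ.* suc n) ⟧ℤ          ≈⟨ neg-homo (+ (m ℕ.* suc n)) ⟩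
    - ((m ℕ.* suc n) · 1#)            ≈⟨ -‿cong (×1-homo-* m (suc n)) ⟩
    - (m · 1# * suc n · 1#)           ≈⟨ -‿distribʳ-* _ _ ⟩
    m · 1# * - (suc n · 1#)           ∎
  *-homo -[1+ m ] (+ n)    = begin
    ⟦ Sign.- ℤ.◃ suc m ℕ.* n ⟧ℤ       ≡⟨ ≡.cong ⟦_⟧ℤ (ℤ.-◃n≡-n (suc m ℕ.* n)) ⟩
    ⟦ ℤ.- + (suc m ℕ.* n) ⟧ℤ          ≈⟨ neg-homo (+ (suc m ℕ.* n)) ⟩
    - ((suc m ℕ.* n) · 1#)            ≈⟨ -‿cong (×1-homo-* (suc m) n) ⟩
    - (suc m · 1# * n · 1#)           ≈⟨ -‿distribˡ-* _ _ ⟩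
    - (suc m · 1#) * n · 1#           ∎
  *-homo -[1+ m ] -[1+ n ] = begin
    (suc m ℕ.* suc n) · 1#                ≈⟨ ×1-homo-* (suc m) (suc n) ⟩
    suc m · 1# * suc n · 1#               ≈⟨ -‿involutive _ ⟨
    - - (suc m · 1# * suc n · 1#)         ≈⟨ -‿cong (-‿distribˡ-* _ _) ⟩
    - (- (suc m · 1#) * suc n · 1#)       ≈⟨ -‿distribʳ-* _ _ ⟩
    - (suc m · 1#) * - (suc n · 1#)       ∎

  morphism : ℤ.+-*-rawRing -Raw-AlmostCommutative⟶ fromCommutativeRing R
  morphism = record
    { ⟦_⟧ = ⟦_⟧ℤ ; +-homo = +-homo ; *-homo = *-homo ; -‿homo = neg-homo ; 0-homo = refl ; 1-homo = refl }

  open Algebra.Solver.Ring ℤ.+-*-rawRing (fromCommutativeRing R) morphism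
    (λ i j → Maybe.map (λ eq → reflexive (≡.cong ⟦_⟧ℤ eq)) (dec⇒maybe (i ℤ.≟ j))) public

module OrderedFieldProperties {c ℓ₁ ℓ₂} (F : OrderedField c ℓ₁ ℓ₂) where
  open import Data.Integer using (+_)
  open OrderedField F
  open Algebra.Properties.Ring ring
  open IsStrictTotalOrder isStrictTotalOrder
    renaming (trans to <-trans; irrefl to <-irrefl; compare to <-compare; <-respˡ-≈ to respˡ; <-respʳ-≈ to respʳ)
    using ()

  Positive : Carrier → Set ℓ₂
  Positive x = 0# < x

  pos-resp : ∀ {x y} → x ≈ y → Positive x → Positive y
  pos-resp = respʳ

  pos≉0 : ∀ {x} → Positive x → ¬ (x ≈ 0#)
  pos≉0 0<x x≈0 = <-irrefl (sym x≈0) 0<x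

  pos-+ : ∀ {x y} → Positive x → Positive y → Positive (x + y)
  pos-+ {x} 0<x 0<y = <-trans 0<x (respˡ (+-identityʳ x) (+-monoʳ-< x 0<y))

  <⇒pos : ∀ {x y} → x < y → Positive (y - x)
  <⇒pos {x} {y} x<y = respˡ (-‿inverseˡ x) (respʳ (+-comm (- x) y) (+-monoʳ-< (- x) x<y))

  pos⇒< : ∀ {x y} → Positive (y - x) → x < y
  pos⇒< {x} {y} 0<y-x = respˡ (+-identityʳ x) (respʳ x+[y-x]≈y (+-monoʳ-< x 0<y-x))
    where
    x+[y-x]≈y : x + (y - x) ≈ y
    x+[y-x]≈y = trans (+-comm x _) (trans (+-assoc y (- x) x) (trans (+-congˡ (-‿inverseˡ x)) (+-identityʳ y)))

  neg-neg : ∀ {x} → Positive x → ¬ Positive (- x)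
  neg-neg {x} 0<x 0<-x = pos≉0 (pos-+ 0<x 0<-x) (-‿inverseʳ x)

  inverse-pos : ∀ {x y} → Positive x → x * y ≈ 1# → Positive y
  inverse-pos {x} {y} 0<x xy≈1 with <-compare 0# y
  ... | tri< 0<y _ _ = 0<y
  ... | tri≈ _ 0≈y _ = contradiction (trans (sym xy≈1) (trans (*-congˡ (sym 0≈y)) (zeroʳ x))) (pos≉0 0<1)
  ... | tri> _ _ y<0 = contradiction
    (pos-resp (trans (sym (-‿distribʳ-* x y)) (-‿cong xy≈1))
      (*-pos 0<x (pos-resp (+-identityˡ (- y)) (<⇒pos y<0))))
    (neg-neg 0<1)

  -- The value at A + t (B − A) of an affine functional with values p at A and
  -- q at B.
  mix : Carrier → Carrier → Carrier → Carrier
  mix t p q = (1# - t) * p + t * q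

  module _ {t p q : Carrier} (mix≈0 : mix t p q ≈ 0#) where

    mix-zeroˡ : p ≈ 0# → Positive q → t ≈ 0#
    mix-zeroˡ p≈0 0<q = by-cases (<-compare 0# t)
      where
      tq≈0 : t * q ≈ 0#
      tq≈0 = trans (sym (+-identityˡ _)) (trans (+-congʳ (sym (trans (*-congˡ p≈0) (zeroʳ _)))) mix≈0)
      -tq≈0 : - t * q ≈ 0#
      -tq≈0 = trans (sym (-‿distribˡ-* t q)) (trans (-‿cong tq≈0) -0#≈0#)
      by-cases : Tri (0# < t) (0# ≈ t) (t < 0#) → t ≈ 0#
      by-cases (tri< 0<t _ _) = contradiction tq≈0 (pos≉0 (*-pos 0<t 0<q))
      by-cases (tri≈ _ 0≈t _) = sym 0≈t
      by-cases (tri> _ _ t<0) =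
        contradiction -tq≈0 (pos≉0 (*-pos (pos-resp (+-identityˡ (- t)) (<⇒pos t<0)) 0<q))

  1-[1-t]≈t : ∀ t → 1# - (1# - t) ≈ t
  1-[1-t]≈t = solve 1 (λ t → con (+ 1) :- (con (+ 1) :- t) := t) refl
    where open IntegerSolver commutativeRing

  mix-swap : ∀ t p q → mix (1# - t) q p ≈ mix t p q
  mix-swap = solve 3 (λ t p q →
      (con (+ 1) :- (con (+ 1) :- t)) :* q :+ (con (+ 1) :- t) :* p :=
      (con (+ 1) :- t) :* p :+ t :* q) refl
    where open IntegerSolver commutativeRing

  mix-zeroʳ : ∀ {t p q} → mix t p q ≈ 0# → q ≈ 0# → Positive p → t ≈ 1#
  mix-zeroʳ {t} {p} {q} mix≈0 q≈0 0<p =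
    trans (sym (1-[1-t]≈t t)) (trans (+-congˡ (-‿cong (mix-zeroˡ (trans (mix-swap t p q) mix≈0) q≈0 0<p)))
      (trans (+-congˡ -0#≈0#) (+-identityʳ 1#)))

  mix-pos : ∀ {t p q} → 0# ≤ t → t ≤ 1# → Positive p → Positive q → Positive (mix t p q)
  mix-pos {t} {p} {q} (inj₁ 0<t) (inj₁ t<1) 0<p 0<q = pos-+ (*-pos (<⇒pos t<1) 0<p) (*-pos 0<t 0<q)
  mix-pos {t} {p} {q} (inj₁ 0<t) (inj₂ t≈1) 0<p 0<q = pos-resp (sym mix≈tq) (*-pos 0<t 0<q)
    where
    mix≈tq : mix t p q ≈ t * q
    mix≈tq = trans (+-congʳ (trans (*-congʳ (trans (+-congˡ (-‿cong t≈1)) (-‿inverseʳ 1#))) (zeroˡ p))) (+-identityˡ _)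
  mix-pos {t} {p} {q} (inj₂ 0≈t) _ 0<p 0<q = pos-resp (sym mix≈p) 0<p
    where
    mix≈p : mix t p q ≈ p
    mix≈p = trans (+-cong (trans (*-congʳ (trans (+-congˡ (trans (-‿cong (sym 0≈t)) -0#≈0#)) (+-identityʳ 1#))) (*-identityˡ p))
                          (trans (*-congʳ (sym 0≈t)) (zeroˡ q))) (+-identityʳ p)

NoncrossingGraph : ∀ {m} → Graph m → Set
NoncrossingGraph {m} G = ∀ {a b c d : Fin m} → a Fin.< b → b Fin.< c → c Fin.< d → Adj G a c → Adj G b d → ⊥

-- The additional vertex has the largest label, so the segment from it to `u` can be crossed only by
-- an edge with one end on either side of `u`.
UnhiddenVertex : ∀ {m} → Graph m → Fin m → Set
UnhiddenVertex G u = ∀ {a b} → a Fin.< u → u Fin.< b → ¬ Adj G a b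

module Orientation {c ℓ₁ ℓ₂} (F : OrderedField c ℓ₁ ℓ₂) where
  open import Data.Integer using (+_)
  open Geometry F
  open OrderedField F
  open OrderedFieldProperties F
  open IntegerSolver commutativeRing

  private
    :orient : ∀ {n} (x₁ y₁ x₂ y₂ x₃ y₃ : Polynomial n) → Polynomial n
    :orient x₁ y₁ x₂ y₂ x₃ y₃ = (x₂ :- x₁) :* (y₃ :- y₁) :- (y₂ :- y₁) :* (x₃ :- x₁)
    :along : ∀ {n} (x₁ x₂ t : Polynomial n) → Polynomial n
    :along x₁ x₂ t = x₁ :+ t :* (x₂ :- x₁)
    :mix : ∀ {n} (t p q : Polynomial n) → Polynomial n
    :mix t p q = (con (+ 1) :- t) :* p :+ t :* q

  orient-cycle : ∀ A B C → orient A B C ≈ orient B C A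
  orient-cycle (x₁ , y₁) (x₂ , y₂) (x₃ , y₃) = solve 6
    (λ x₁ y₁ x₂ y₂ x₃ y₃ → :orient x₁ y₁ x₂ y₂ x₃ y₃ := :orient x₂ y₂ x₃ y₃ x₁ y₁) refl x₁ y₁ x₂ y₂ x₃ y₃

  orient-left : ∀ A B → orient A B A ≈ 0#
  orient-left (x₁ , y₁) (x₂ , y₂) = solve 4
    (λ x₁ y₁ x₂ y₂ → :orient x₁ y₁ x₂ y₂ x₁ y₁ := con (+ 0)) refl x₁ y₁ x₂ y₂

  orient-right : ∀ A B → orient A B B ≈ 0#
  orient-right (x₁ , y₁) (x₂ , y₂) = solve 4
    (λ x₁ y₁ x₂ y₂ → :orient x₁ y₁ x₂ y₂ x₂ y₂ := con (+ 0)) refl x₁ y₁ x₂ y₂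

  orient-along : ∀ A B C D t → orient A B (along C D t) ≈ mix t (orient A B C) (orient A B D)
  orient-along (x₁ , y₁) (x₂ , y₂) (x₃ , y₃) (x₄ , y₄) = solve 9
    (λ x₁ y₁ x₂ y₂ x₃ y₃ x₄ y₄ t →
      :orient x₁ y₁ x₂ y₂ (:along x₃ x₄ t) (:along y₃ y₄ t) :=
      :mix t (:orient x₁ y₁ x₂ y₂ x₃ y₃) (:orient x₁ y₁ x₂ y₂ x₄ y₄)) refl x₁ y₁ x₂ y₂ x₃ y₃ x₄ y₄

  -- For a convex quadrilateral ABCD both sums are twice its area, cut along BD on the left and
  -- along AC on the right.
  orient-split : ∀ A B C D → orient A B D + orient B C D ≈ orient A B C + orient A C D
  orient-split (x₁ , y₁) (x₂ , y₂) (x₃ , y₃) (x₄ , y₄) = solve 8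
    (λ x₁ y₁ x₂ y₂ x₃ y₃ x₄ y₄ →
      :orient x₁ y₁ x₂ y₂ x₄ y₄ :+ :orient x₂ y₂ x₃ y₃ x₄ y₄ :=
      :orient x₁ y₁ x₂ y₂ x₃ y₃ :+ :orient x₁ y₁ x₃ y₃ x₄ y₄) refl x₁ y₁ x₂ y₂ x₃ y₃ x₄ y₄

  -- The division-free form of A + (ABD/Δ)(C - A) = B + (ABC/Δ)(D - B). As a polynomial identity it
  -- is within reach of the solver; `rescale` then divides by Δ.
  orient-crossing : ∀ x₁ y₁ x₂ y₂ x₃ y₃ x₄ y₄ →
    let A = x₁ , y₁ ; B = x₂ , y₂ ; C = x₃ , y₃ ; D = x₄ , y₄ ; Δ = orient A B D + orient B C D in
    (Δ * x₁ + orient A B D * (x₃ - x₁) ≈ Δ * x₂ + orient A B C * (x₄ - x₂)) ×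
    (Δ * y₁ + orient A B D * (y₃ - y₁) ≈ Δ * y₂ + orient A B C * (y₄ - y₂))
  orient-crossing x₁ y₁ x₂ y₂ x₃ y₃ x₄ y₄ =
    solve 8 (λ x₁ y₁ x₂ y₂ x₃ y₃ x₄ y₄ →
      (:orient x₁ y₁ x₂ y₂ x₄ y₄ :+ :orient x₂ y₂ x₃ y₃ x₄ y₄) :* x₁ :+ :orient x₁ y₁ x₂ y₂ x₄ y₄ :* (x₃ :- x₁) :=
      (:orient x₁ y₁ x₂ y₂ x₄ y₄ :+ :orient x₂ y₂ x₃ y₃ x₄ y₄) :* x₂ :+ :orient x₁ y₁ x₂ y₂ x₃ y₃ :* (x₄ :- x₂))
      refl x₁ y₁ x₂ y₂ x₃ y₃ x₄ y₄ ,
    solve 8 (λ x₁ y₁ x₂ y₂ x₃ y₃ x₄ y₄ →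
      (:orient x₁ y₁ x₂ y₂ x₄ y₄ :+ :orient x₂ y₂ x₃ y₃ x₄ y₄) :* y₁ :+ :orient x₁ y₁ x₂ y₂ x₄ y₄ :* (y₃ :- y₁) :=
      (:orient x₁ y₁ x₂ y₂ x₄ y₄ :+ :orient x₂ y₂ x₃ y₃ x₄ y₄) :* y₂ :+ :orient x₁ y₁ x₂ y₂ x₃ y₃ :* (y₄ :- y₂))
      refl x₁ y₁ x₂ y₂ x₃ y₃ x₄ y₄

  rescale : ∀ {Δ I} → Δ * I ≈ 1# → ∀ {α γ x y z w} → Δ * x + α * z ≈ Δ * y + γ * w →
            x + α * I * z ≈ y + γ * I * w
  rescale {Δ} {I} ΔI≈1 eq = trans (expand _ _ _) (trans (*-congˡ eq) (sym (expand _ _ _)))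
    where
    expand : ∀ α x z → x + α * I * z ≈ I * (Δ * x + α * z)
    expand α x z = trans (+-congʳ (trans (sym (*-identityˡ x)) (*-congʳ (sym ΔI≈1))))
      (solve 5 (λ Δ I α x z → Δ :* I :* x :+ α :* I :* z := I :* (Δ :* x :+ α :* z)) refl Δ I α x z)

  share<1 : ∀ {Δ I α β} → Δ * I ≈ 1# → Δ ≈ α + β → Positive I → Positive β → α * I < 1#
  share<1 {Δ} {I} {α} {β} ΔI≈1 Δ≈ 0<I 0<β = pos⇒< (pos-resp βI≈ (*-pos 0<β 0<I))
    where
    βI≈ : β * I ≈ 1# - α * I
    βI≈ = trans (solve 3 (λ I α β → β :* I := (α :+ β) :* I :- α :* I) refl I α β)
                (+-congʳ (trans (*-congʳ (sym Δ≈)) ΔI≈1))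

  orient-congʳ : ∀ A B {C D} → C ≈ₚ D → orient A B C ≈ orient A B D
  orient-congʳ A B (x≈ , y≈) = +-cong (*-congˡ (+-congʳ y≈)) (-‿cong (*-congˡ (+-congʳ x≈)))

  ≈ₚ-trans : ∀ {A B C} → A ≈ₚ B → B ≈ₚ C → A ≈ₚ C
  ≈ₚ-trans (p , q) (p′ , q′) = trans p p′ , trans q q′

  along-flip : ∀ A B t → along A B t ≈ₚ along B A (1# - t)
  along-flip (x₁ , y₁) (x₂ , y₂) t = flip x₁ x₂ t , flip y₁ y₂ t
    where
    flip : ∀ x y t → x + t * (y - x) ≈ y + (1# - t) * (x - y)
    flip = solve 3 (λ x y t → :along x y t := :along y x (con (+ 1) :- t)) refl

  along-0 : ∀ A B {t} → t ≈ 0# → along A B t ≈ₚ A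
  along-0 (x₁ , y₁) (x₂ , y₂) t≈0 = at0 x₁ x₂ , at0 y₁ y₂
    where
    at0 : ∀ x y → x + _ * (y - x) ≈ x
    at0 x y = trans (+-congˡ (trans (*-congʳ t≈0) (zeroˡ _))) (+-identityʳ x)

  along-1 : ∀ A B {t} → t ≈ 1# → along A B t ≈ₚ B
  along-1 (x₁ , y₁) (x₂ , y₂) {t} t≈1 = at1 x₁ x₂ , at1 y₁ y₂
    where
    at1 : ∀ x y → x + t * (y - x) ≈ y
    at1 x y = trans (+-congˡ (*-congʳ t≈1)) (solve 2 (λ x y → x :+ con (+ 1) :* (y :- x) := y) refl x y)

  0≤⇒1-≤1 : ∀ {t} → 0# ≤ t → 1# - t ≤ 1#
  0≤⇒1-≤1 {t} (inj₁ 0<t) = inj₁ (pos⇒< (pos-resp (sym (1-[1-t]≈t t)) 0<t))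
  0≤⇒1-≤1 {t} (inj₂ 0≈t) = inj₂ (trans (+-congˡ (-‿cong (sym 0≈t))) (solve 0 (con (+ 1) :- con (+ 0) := con (+ 1)) refl))

  ≤1⇒0≤1- : ∀ {t} → t ≤ 1# → 0# ≤ 1# - t
  ≤1⇒0≤1- (inj₁ t<1) = inj₁ (<⇒pos t<1)
  ≤1⇒0≤1- (inj₂ t≈1) = inj₂ (sym (trans (+-congˡ (-‿cong t≈1)) (-‿inverseʳ 1#)))

  OnSegment-flip : ∀ {A B Q} → OnSegment A B Q → OnSegment B A Q
  OnSegment-flip {A} {B} (t , 0≤t , t≤1 , Q≈) = 1# - t , ≤1⇒0≤1- t≤1 , 0≤⇒1-≤1 0≤t , ≈ₚ-trans Q≈ (along-flip A B t)

  InInterior-flip : ∀ {A B Q} → InInterior A B Q → InInterior B A Q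
  InInterior-flip {A} {B} (t , 0<t , t<1 , Q≈) =
    1# - t , <⇒pos t<1 , pos⇒< (pos-resp (sym (1-[1-t]≈t t)) 0<t) , ≈ₚ-trans Q≈ (along-flip A B t)

  interior⊆segment : ∀ {A B Q} → InInterior A B Q → OnSegment A B Q
  interior⊆segment (t , 0<t , t<1 , Q≈) = t , inj₁ 0<t , inj₁ t<1 , Q≈

  OnSegment-orient : ∀ {A B Q} → OnSegment A B Q → orient A B Q ≈ 0#
  OnSegment-orient {A} {B} (t , _ , _ , Q≈) = trans (orient-congʳ A B Q≈) (trans (orient-along A B A B t)
    (trans (+-cong (trans (*-congˡ (orient-left A B)) (zeroʳ _)) (trans (*-congˡ (orient-right A B)) (zeroʳ t)))
           (+-identityˡ 0#)))

  -- The diagonals meet where AC is divided in the ratio ABD : BCD of areas,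
  -- and BD in the ratio ABC : ACD.
  diagonals-meet : ∀ A B C D → Positive (orient A B C) → Positive (orient A B D) →
                   Positive (orient A C D) → Positive (orient B C D) →
                   ∃ λ Q → InInterior A C Q × InInterior B D Q
  diagonals-meet A@(x₁ , y₁) B@(x₂ , y₂) C@(x₃ , y₃) D@(x₄ , y₄) abc abd acd bcd
    with I , ΔI≈1 ← inverse (orient A B D + orient B C D) (pos≉0 (pos-+ abd bcd)) =
      along A C (orient A B D * I)
    , (orient A B D * I , *-pos abd 0<I , share<1 ΔI≈1 refl 0<I bcd , refl , refl)
    , (orient A B C * I , *-pos abc 0<I , share<1 ΔI≈1 (orient-split A B C D) 0<I acd
      , rescale ΔI≈1 (proj₁ crossing) , rescale ΔI≈1 (proj₂ crossing))
    where
    0<I : Positive I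
    0<I = inverse-pos (pos-+ abd bcd) ΔI≈1
    crossing = orient-crossing x₁ y₁ x₂ y₂ x₃ y₃ x₄ y₄

  module Convex {m} (pt : Fin m → Point) (convex : ConvexCCW pt) where

    outside : ∀ {u v w} → u Fin.< v → w Fin.< u ⊎ v Fin.< w → Positive (orient (pt u) (pt v) (pt w))
    outside u<v (inj₁ w<u) = pos-resp (orient-cycle _ _ _) (convex w<u u<v)
    outside u<v (inj₂ v<w) = convex u<v v<w

    inside : ∀ {u v w} → u Fin.< w → w Fin.< v → Positive (orient (pt v) (pt u) (pt w))
    inside u<w w<v = pos-resp (trans (orient-cycle _ _ _) (orient-cycle _ _ _)) (convex u<w w<v)

    crossing-meets : ∀ {a b c d} → a Fin.< b → b Fin.< c → c Fin.< d →
                     ∃ λ Q → InInterior (pt a) (pt c) Q × InInterior (pt b) (pt d) Q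
    crossing-meets {a} {b} {c} {d} a<b b<c c<d = diagonals-meet (pt a) (pt b) (pt c) (pt d)
      (convex a<b b<c) (convex a<b (ℕ.<-trans b<c c<d)) (convex (ℕ.<-trans a<b b<c) c<d) (convex b<c c<d)

    Endpoint : Fin m → Fin m → Fin m → Set
    Endpoint u v w = w ≡ u ⊎ w ≡ v

    data Position (u v w : Fin m) : Set where
      at  : Endpoint u v w → Position u v w
      mid : u Fin.< w → w Fin.< v → Position u v w
      out : w Fin.< u ⊎ v Fin.< w → Position u v w

    position : ∀ u v w → Position u v w
    position u v w with Fin.<-cmp w u | Fin.<-cmp w v
    ... | tri< w<u _ _ | _            = out (inj₁ w<u)
    ... | tri≈ _ w≡u _ | _            = at (inj₁ w≡u)
    ... | tri> _ _ u<w | tri< w<v _ _ = mid u<w w<v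
    ... | tri> _ _ u<w | tri≈ _ w≡v _ = at (inj₂ w≡v)
    ... | tri> _ _ u<w | tri> _ _ v<w = out (inj₂ v<w)

    ends-distinct : ∀ {u v x y} → u Fin.< v → x Fin.< y → ¬ (u ≡ x × v ≡ y) → ¬ (Endpoint u v x × Endpoint u v y)
    ends-distinct u<v x<y uv≢xy (inj₁ ≡.refl , inj₁ ≡.refl) = ℕ.<-irrefl ≡.refl x<y
    ends-distinct u<v x<y uv≢xy (inj₁ ≡.refl , inj₂ ≡.refl) = uv≢xy (≡.refl , ≡.refl)
    ends-distinct u<v x<y uv≢xy (inj₂ ≡.refl , inj₁ ≡.refl) = ℕ.<-asym u<v x<y
    ends-distinct u<v x<y uv≢xy (inj₂ ≡.refl , inj₂ ≡.refl) = ℕ.<-irrefl ≡.refl x<y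

    Meeting : Fin m → Fin m → Fin m → Fin m → Carrier → Set ℓ₁
    Meeting u v x y t = (t ≈ 0# × Endpoint u v x) ⊎ (t ≈ 1# × Endpoint u v y)

    module _ {u v x y Q t} (Q∈uv : OnSegment (pt u) (pt v) Q) (Q≈ : Q ≈ₚ along (pt x) (pt y) t)
             (0≤t : 0# ≤ t) (t≤1 : t ≤ 1#) where

      data Side (A B : Point) (w : Fin m) : Set (ℓ₁ ⊔ ℓ₂) where
        on   : Endpoint u v w → orient A B (pt w) ≈ 0# → Side A B w
        left : Positive (orient A B (pt w)) → Side A B w

      -- Along xy the functional `orient A B` is affine, and it vanishes at Q. It is nonnegative at
      -- x and y, and positive at one of them because they are not both ends of uv. So it is zero at
      -- the other one, Q is that point, and `on` records that it is an end of uv.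
      same-side : ∀ {A B} → orient A B Q ≈ 0# → ¬ (Endpoint u v x × Endpoint u v y) →
                  Side A B x → Side A B y → Meeting u v x y t
      same-side {A} {B} Q≈0 distinct s s′ = go s s′
        where
        mix≈0 : mix t (orient A B (pt x)) (orient A B (pt y)) ≈ 0#
        mix≈0 = trans (sym (orient-along A B (pt x) (pt y) t)) (trans (sym (orient-congʳ A B Q≈)) Q≈0)
        go : Side A B x → Side A B y → Meeting u v x y t
        go (on ex _) (on ey _)    = contradiction (ex , ey) distinct
        go (on ex x≈0) (left y>0) = inj₁ (mix-zeroˡ mix≈0 x≈0 y>0 , ex)
        go (left x>0) (on ey y≈0) = inj₂ (mix-zeroʳ mix≈0 y≈0 x>0 , ey)
        go (left x>0) (left y>0)  = contradiction mix≈0 (pos≉0 (mix-pos 0≤t t≤1 x>0 y>0))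

      Q-uv : orient (pt u) (pt v) Q ≈ 0#
      Q-uv = OnSegment-orient Q∈uv

      Q-vu : orient (pt v) (pt u) Q ≈ 0#
      Q-vu = OnSegment-orient (OnSegment-flip Q∈uv)

      on-uv : ∀ {w} → Endpoint u v w → Side (pt u) (pt v) w
      on-uv e@(inj₁ ≡.refl) = on e (orient-left (pt u) (pt v))
      on-uv e@(inj₂ ≡.refl) = on e (orient-right (pt u) (pt v))

      on-vu : ∀ {w} → Endpoint u v w → Side (pt v) (pt u) w
      on-vu e@(inj₁ ≡.refl) = on e (orient-right (pt v) (pt u))
      on-vu e@(inj₂ ≡.refl) = on e (orient-left (pt v) (pt u))

      -- Without a crossing, x and y are both to the left of or on the line uv in
      -- one of its two directions.
      meet : u Fin.< v → x Fin.< y → ¬ (u ≡ x × v ≡ y) →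
             ¬ (x Fin.< u × u Fin.< y × y Fin.< v) → ¬ (u Fin.< x × x Fin.< v × v Fin.< y) →
             Meeting u v x y t
      meet u<v x<y uv≢xy ¬xuyv ¬uxvy with position u v x | position u v y
      ... | at ex      | at ey      = contradiction (ex , ey) (ends-distinct u<v x<y uv≢xy)
      ... | at ex      | mid u<y y<v = same-side Q-vu (ends-distinct u<v x<y uv≢xy) (on-vu ex) (left (inside u<y y<v))
      ... | at ex      | out y∉     = same-side Q-uv (ends-distinct u<v x<y uv≢xy) (on-uv ex) (left (outside u<v y∉))
      ... | mid u<x x<v | at ey      = same-side Q-vu (ends-distinct u<v x<y uv≢xy) (left (inside u<x x<v)) (on-vu ey)
      ... | mid u<x x<v | mid u<y y<v =
        same-side Q-vu (ends-distinct u<v x<y uv≢xy) (left (inside u<x x<v)) (left (inside u<y y<v))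
      ... | mid u<x x<v | out (inj₁ y<u) = contradiction (ℕ.<-trans y<u u<x) (ℕ.<-asym x<y)
      ... | mid u<x x<v | out (inj₂ v<y) = contradiction (u<x , x<v , v<y) ¬uxvy
      ... | out x∉     | at ey      = same-side Q-uv (ends-distinct u<v x<y uv≢xy) (left (outside u<v x∉)) (on-uv ey)
      ... | out (inj₁ x<u) | mid u<y y<v = contradiction (x<u , u<y , y<v) ¬xuyv
      ... | out (inj₂ v<x) | mid u<y y<v = contradiction (ℕ.<-trans y<v v<x) (ℕ.<-asym x<y)
      ... | out x∉     | out y∉     =
        same-side Q-uv (ends-distinct u<v x<y uv≢xy) (left (outside u<v x∉)) (left (outside u<v y∉))

    CommonEnd : Fin m → Fin m → Fin m → Fin m → Point → Set ℓ₁
    CommonEnd u v x y Q = ∃ λ w → (w ≡ u ⊎ w ≡ v) × (w ≡ x ⊎ w ≡ y) × (Q ≈ₚ pt w)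

    no-common-end : ∀ {a b c d Q} → a Fin.< b → b Fin.< c → c Fin.< d → ¬ CommonEnd a c b d Q
    no-common-end a<b b<c c<d (_ , inj₁ ≡.refl , inj₁ ≡.refl , _) = ℕ.<-irrefl ≡.refl a<b
    no-common-end a<b b<c c<d (_ , inj₁ ≡.refl , inj₂ ≡.refl , _) = ℕ.<-asym (ℕ.<-trans a<b b<c) c<d
    no-common-end a<b b<c c<d (_ , inj₂ ≡.refl , inj₁ ≡.refl , _) = ℕ.<-irrefl ≡.refl b<c
    no-common-end a<b b<c c<d (_ , inj₂ ≡.refl , inj₂ ≡.refl , _) = ℕ.<-irrefl ≡.refl c<d

    crossing-distinct : ∀ {a b c d : Fin m} → a Fin.< b → b Fin.< c → c Fin.< d →
                        ¬ ((a ≡ b × c ≡ d) ⊎ (a ≡ d × c ≡ b))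
    crossing-distinct a<b b<c c<d (inj₁ (≡.refl , _)) = ℕ.<-irrefl ≡.refl a<b
    crossing-distinct a<b b<c c<d (inj₂ (_ , ≡.refl)) = ℕ.<-irrefl ≡.refl b<c

    Plane⇒noncrossing : ∀ {G} → Plane pt G → NoncrossingGraph G
    Plane⇒noncrossing {G} plane {a} {b} {c} {d} a<b b<c c<d ac bd =
      absurd (crossing-meets a<b b<c c<d)
      where
      absurd : (∃ λ Q → InInterior (pt a) (pt c) Q × InInterior (pt b) (pt d) Q) → ⊥
      absurd (Q , Q∈ac , Q∈bd) = no-common-end {Q = Q} a<b b<c c<d
        (plane {a} {c} {b} {d} ac bd (crossing-distinct a<b b<c c<d) Q
          (interior⊆segment {pt a} {pt c} {Q} Q∈ac) (interior⊆segment {pt b} {pt d} {Q} Q∈bd))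

    swapˡ : ∀ {u v x y Q} → CommonEnd v u x y Q → CommonEnd u v x y Q
    swapˡ (w , e , e′ , Q≈) = w , Sum.swap e , e′ , Q≈

    swapʳ : ∀ {u v x y Q} → CommonEnd u v y x Q → CommonEnd u v x y Q
    swapʳ (w , e , e′ , Q≈) = w , e , Sum.swap e′ , Q≈

    ordered : ∀ G u v x y Q → NoncrossingGraph G → Adj G u v → Adj G x y → u Fin.< v → x Fin.< y →
              ¬ (u ≡ x × v ≡ y) → OnSegment (pt u) (pt v) Q → OnSegment (pt x) (pt y) Q → CommonEnd u v x y Q
    ordered G u v x y Q nc uv xy u<v x<y uv≢xy Q∈uv (t , 0≤t , t≤1 , Q≈) =
      common (meet {u} {v} {x} {y} {Q} {t} Q∈uv Q≈ 0≤t t≤1 u<v x<y uv≢xy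
             (λ { (x<u , u<y , y<v) → nc x<u u<y y<v xy uv }) (λ { (u<x , x<v , v<y) → nc u<x x<v v<y uv xy }))
      where
      common : Meeting u v x y t → CommonEnd u v x y Q
      common (inj₁ (t≈0 , e)) = x , e , inj₁ ≡.refl ,
        ≈ₚ-trans {Q} {along (pt x) (pt y) t} {pt x} Q≈ (along-0 (pt x) (pt y) t≈0)
      common (inj₂ (t≈1 , e)) = y , e , inj₂ ≡.refl ,
        ≈ₚ-trans {Q} {along (pt x) (pt y) t} {pt y} Q≈ (along-1 (pt x) (pt y) t≈1)

    noncrossing⇒Plane : ∀ {G} → NoncrossingGraph G → Plane pt G
    noncrossing⇒Plane {G} nc {u} {v} {x} {y} uv xy uv≢xy Q Q∈uv Q∈xy = by-cases (Fin.<-cmp u v) (Fin.<-cmp x y)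
      where
      vu = ≡.trans (symm G v u) uv
      yx = ≡.trans (symm G y x) xy
      Q∈vu = OnSegment-flip {pt u} {pt v} {Q} Q∈uv
      Q∈yx = OnSegment-flip {pt x} {pt y} {Q} Q∈xy
      by-cases : Tri (u Fin.< v) (u ≡ v) (v Fin.< u) → Tri (x Fin.< y) (x ≡ y) (y Fin.< x) → CommonEnd u v x y Q
      by-cases (tri≈ _ u≡v _) _ = contradiction (≡.trans (≡.sym uv) (≡.trans (≡.cong (adj G u) (≡.sym u≡v)) (irrefl G u))) λ ()
      by-cases _ (tri≈ _ x≡y _) = contradiction (≡.trans (≡.sym xy) (≡.trans (≡.cong (adj G x) (≡.sym x≡y)) (irrefl G x))) λ ()
      by-cases (tri< u<v _ _) (tri< x<y _ _) = ordered G u v x y Q nc uv xy u<v x<y (uv≢xy ∘ inj₁) Q∈uv Q∈xy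
      by-cases (tri< u<v _ _) (tri> _ _ y<x) =
        swapʳ {u} {v} {x} {y} {Q} (ordered G u v y x Q nc uv yx u<v y<x (uv≢xy ∘ inj₂) Q∈uv Q∈yx)
      by-cases (tri> _ _ v<u) (tri< x<y _ _) =
        swapˡ {u} {v} {x} {y} {Q} (ordered G v u x y Q nc vu xy v<u x<y (uv≢xy ∘ inj₂ ∘ swap) Q∈vu Q∈xy)
      by-cases (tri> _ _ v<u) (tri> _ _ y<x) =
        swapˡ {u} {v} {x} {y} {Q} (swapʳ {v} {u} {x} {y} {Q}
          (ordered G v u y x Q nc vu yx v<u y<x (uv≢xy ∘ inj₁ ∘ swap) Q∈vu Q∈yx))

  module Extended {i} (pt : Fin (suc i) → Point) (convex : ConvexCCW pt) where
    open Convex pt convex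

    old : Fin i → Point
    old w = pt (inject₁ w)

    inject₁-< : ∀ {a b : Fin i} → a Fin.< b → inject₁ a Fin.< inject₁ b
    inject₁-< {a} {b} = ≡.subst₂ ℕ._<_ (≡.sym (Fin.toℕ-inject₁ a)) (≡.sym (Fin.toℕ-inject₁ b))

    inject₁-<⁻¹ : ∀ {a b : Fin i} → inject₁ a Fin.< inject₁ b → a Fin.< b
    inject₁-<⁻¹ {a} {b} = ≡.subst₂ ℕ._<_ (Fin.toℕ-inject₁ a) (Fin.toℕ-inject₁ b)

    inject₁-<-last : ∀ (a : Fin i) → inject₁ a Fin.< fromℕ i
    inject₁-<-last a = ≡.subst₂ ℕ._<_ (≡.sym (Fin.toℕ-inject₁ a)) (≡.sym (Fin.toℕ-fromℕ i)) (Fin.toℕ<n a)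

    old-convex : ConvexCCW old
    old-convex u<v v<w = convex (inject₁-< u<v) (inject₁-< v<w)

    Visible⇒unhidden : ∀ {G u} → Visible old G (pt (fromℕ i)) (old u) → UnhiddenVertex G u
    Visible⇒unhidden {G} {u} visible {a} {b} a<u u<b ab =
      absurd (crossing-meets (inject₁-< a<u) (inject₁-< u<b) (inject₁-<-last b))
      where
      absurd : (∃ λ Q → InInterior (old a) (old b) Q × InInterior (old u) (pt (fromℕ i)) Q) → ⊥
      absurd (Q , Q∈ab , Q∈u) = visible {a} {b} ab Q
        (OnSegment-flip {old u} {pt (fromℕ i)} {Q} (interior⊆segment {old u} {pt (fromℕ i)} {Q} Q∈u)) Q∈ab

    -- The line of sight is itself a chord between labelled points of the convex polygon, so `meet`
    -- applies to it as to an edge. It leaves only an end of ab as a common point, which is not in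
    -- the interior.
    ordered-visible : ∀ G u a b Q → UnhiddenVertex G u → Adj G a b → a Fin.< b →
                      OnSegment (pt (fromℕ i)) (old u) Q → InInterior (old a) (old b) Q → ⊥
    ordered-visible G u a b Q unhidden ab a<b Q∈u (t , 0<t , t<1 , Q≈) =
      absurd (meet {inject₁ u} {fromℕ i} {inject₁ a} {inject₁ b} {Q} {t}
        (OnSegment-flip {pt (fromℕ i)} {old u} {Q} Q∈u) Q≈ (inj₁ 0<t) (inj₁ t<1) (inject₁-<-last u) (inject₁-< a<b)
        (λ { (_ , last≡b) → ℕ.<⇒≢ (inject₁-<-last b) (≡.cong toℕ (≡.sym last≡b)) })
        (λ { (a<u , u<b , _) → unhidden (inject₁-<⁻¹ a<u) (inject₁-<⁻¹ u<b) ab })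
        (λ { (_ , _ , last<b) → ℕ.<-asym last<b (inject₁-<-last b) }))
      where
      absurd : Meeting (inject₁ u) (fromℕ i) (inject₁ a) (inject₁ b) t → ⊥
      absurd (inj₁ (t≈0 , _)) = pos≉0 0<t t≈0
      absurd (inj₂ (t≈1 , _)) = IsStrictTotalOrder.irrefl isStrictTotalOrder t≈1 t<1

    unhidden⇒Visible : ∀ {G u} → UnhiddenVertex G u → Visible old G (pt (fromℕ i)) (old u)
    unhidden⇒Visible {G} {u} unhidden {a} {b} ab Q Q∈u Q∈ab = by-cases (Fin.<-cmp a b)
      where
      by-cases : Tri (a Fin.< b) (a ≡ b) (b Fin.< a) → ⊥
      by-cases (tri< a<b _ _) = ordered-visible G u a b Q unhidden ab a<b Q∈u Q∈ab
      by-cases (tri≈ _ a≡b _) = contradiction (≡.trans (≡.sym ab) (≡.trans (≡.cong (adj G a) (≡.sym a≡b)) (irrefl G a))) λ ()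
      by-cases (tri> _ _ b<a) = ordered-visible G u b a Q unhidden (≡.trans (symm G b a) ab) b<a Q∈u
        (InInterior-flip {old a} {old b} {Q} Q∈ab)

open import Algebra.Properties.CommutativeMonoid.Sum ℕ.+-0-commutativeMonoid using (sum; sum-cong-≗)
open import Data.Fin using (zero; suc)
open import Data.Nat using (_+_; _*_; _∸_; _^_; _≤_; _<_; _≤ᵇ_; z≤n; s≤s; s≤s⁻¹; _≟_; _≤?_; _<?_)
open import Data.Nat.Properties hiding (_≟_; _≤?_; _<?_)
open import Relation.Binary.PropositionalEquality hiding (_≡_; _≢_; _≗_)

-- Convolutions and the matrix

open ≡-Reasoning

infixl 7 _⊛_

_⊛_ : (ℕ → ℕ) → (ℕ → ℕ) → ℕ → ℕ
(f ⊛ g) zero    = f 0 * g 0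
(f ⊛ g) (suc n) = f 0 * g (suc n) + ((f ∘ suc) ⊛ g) n

⊛-cong : ∀ {f f′ g g′} n → (∀ k → k ≤ n → f k ≡ f′ k) → (∀ k → k ≤ n → g k ≡ g′ k) →
         (f ⊛ g) n ≡ (f′ ⊛ g′) n
⊛-cong zero    p q = cong₂ _*_ (p 0 z≤n) (q 0 z≤n)
⊛-cong (suc n) p q = cong₂ _+_ (cong₂ _*_ (p 0 z≤n) (q (suc n) ≤-refl))
  (⊛-cong n (λ k k≤n → p (suc k) (s≤s k≤n)) (λ k k≤n → q k (m≤n⇒m≤1+n k≤n)))

-- The combination `c * f k + f′ k` is the form to which a convolution unfolds at `suc k`, so this
-- single law carries the induction for associativity.
⊛-linearˡ : ∀ c f f′ g n → ((λ k → c * f k + f′ k) ⊛ g) n ≡ c * (f ⊛ g) n + (f′ ⊛ g) n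
⊛-linearˡ c f f′ g zero = arith c (f 0) (f′ 0) (g 0)
  where
  arith : ∀ c x y z → (c * x + y) * z ≡ c * (x * z) + y * z
  arith = solve-∀
⊛-linearˡ c f f′ g (suc n)
  rewrite ⊛-linearˡ c (f ∘ suc) (f′ ∘ suc) g n =
  arith c (f 0) (f′ 0) (g (suc n)) _ _
  where
  arith : ∀ c x y z u v → (c * x + y) * z + (c * u + v) ≡ c * (x * z + u) + (y * z + v)
  arith = solve-∀

⊛-linearʳ : ∀ c f g g′ n → (f ⊛ (λ k → c * g k + g′ k)) n ≡ c * (f ⊛ g) n + (f ⊛ g′) n
⊛-linearʳ c f g g′ zero = arith c (f 0) (g 0) (g′ 0)
  where
  arith : ∀ c x y z → x * (c * y + z) ≡ c * (x * y) + x * z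
  arith = solve-∀
⊛-linearʳ c f g g′ (suc n)
  rewrite ⊛-linearʳ c (f ∘ suc) g g′ n =
  arith c (f 0) (g (suc n)) (g′ (suc n)) _ _
  where
  arith : ∀ c x y z u v → x * (c * y + z) + (c * u + v) ≡ c * (x * y + u) + (x * z + v)
  arith = solve-∀

⊛-assoc : ∀ f g h n → ((f ⊛ g) ⊛ h) n ≡ (f ⊛ (g ⊛ h)) n
⊛-assoc f g h zero    = *-assoc (f 0) (g 0) (h 0)
⊛-assoc f g h (suc n)
  rewrite ⊛-linearˡ (f 0) (g ∘ suc) ((f ∘ suc) ⊛ g) h n
        | ⊛-assoc (f ∘ suc) g h n =
  arith (f 0) (g 0) (h (suc n)) _ _
  where
  arith : ∀ x y z u v → x * y * z + (x * u + v) ≡ x * (y * z + u) + v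
  arith = solve-∀

δ : ℕ → ℕ → ℕ
δ zero    zero    = 1
δ zero    (suc _) = 0
δ (suc _) zero    = 0
δ (suc p) (suc a) = δ p a

⊛-δ-suc : ∀ f p n → (f ⊛ δ (suc p)) (suc n) ≡ (f ⊛ δ p) n
⊛-δ-suc f p zero    = trans (cong (f 0 * δ p 0 +_) (*-zeroʳ (f 1))) (+-identityʳ _)
⊛-δ-suc f p (suc n) = cong (f 0 * δ p (suc n) +_) (⊛-δ-suc (f ∘ suc) p n)

⊛-δ-zero : ∀ f n → (f ⊛ δ 0) n ≡ f n
⊛-δ-zero f zero    = *-identityʳ (f 0)
⊛-δ-zero f (suc n) rewrite *-zeroʳ (f 0) = ⊛-δ-zero (f ∘ suc) n

⊛-δ-≤ : ∀ f {p n} → p ≤ n → (f ⊛ δ p) n ≡ f (n ∸ p)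
⊛-δ-≤ f {zero}          _       = ⊛-δ-zero f _
⊛-δ-≤ f {suc p} (s≤s p≤n) = trans (⊛-δ-suc f p _) (⊛-δ-≤ f p≤n)

⊛-δ-> : ∀ f {p n} → n < p → (f ⊛ δ p) n ≡ 0
⊛-δ-> f {suc p} {zero}  _         = *-zeroʳ (f 0)
⊛-δ-> f {suc p} {suc n} (s≤s n<p) = trans (⊛-δ-suc f p n) (⊛-δ-> f n<p)

ones pows : ℕ → ℕ
ones _ = 1
pows   = 2 ^_

ones⊛pows : ∀ n → (ones ⊛ pows) n ≡ 2 ^ suc n ∸ 1
ones⊛pows n = trans (sym (m+n∸m≡n 1 _)) (cong (_∸ 1) (suc-sum n))
  where
  arith : ∀ x y → suc (x + (x + 0) + 0 + y) ≡ (x + (x + 0)) + suc y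
  arith = solve-∀
  suc-sum : ∀ n → suc ((ones ⊛ pows) n) ≡ 2 ^ suc n
  suc-sum zero    = refl
  suc-sum (suc n) = begin
    suc (2 ^ suc n + 0 + (ones ⊛ pows) n)   ≡⟨ arith (2 ^ n) _ ⟩
    2 ^ suc n + suc ((ones ⊛ pows) n)       ≡⟨ cong (2 ^ suc n +_) (suc-sum n) ⟩
    2 ^ suc n + 2 ^ suc n                   ≡⟨ cong (2 ^ suc n +_) (+-identityʳ _) ⟨
    2 ^ suc (suc n)                         ∎

step : (ℕ → ℕ) → ℕ → ℕ
step f = ones ⊛ (pows ⊛ (f ∘ suc))

step-cong : ∀ f g n → (∀ a → a ≤ n → f (suc a) ≡ g (suc a)) → step f n ≡ step g n
step-cong f g n p = ⊛-cong n (λ _ _ → refl) λ k k≤n →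
  ⊛-cong k (λ _ _ → refl) (λ a a≤k → p a (≤-trans a≤k k≤n))

step-linear : ∀ c f g n → step (λ k → c * f k + g k) n ≡ c * step f n + step g n
step-linear c f g n = trans
  (⊛-cong n (λ _ _ → refl) (λ k _ → ⊛-linearʳ c pows (f ∘ suc) (g ∘ suc) k))
  (⊛-linearʳ c ones (pows ⊛ (f ∘ suc)) (pows ⊛ (g ∘ suc)) n)

-- A Leibniz rule: `(f ⊛ g) ∘ suc` is `f 0` times `g ∘ suc` plus `(f ∘ suc) ⊛ g`, and associativity
-- lets the outer convolutions act on the factor that carries the `suc`.
step-⊛ : ∀ f g n → step (f ⊛ g) n ≡ f 0 * step g n + (step f ⊛ g) n
step-⊛ f g n = begin
  step (f ⊛ g) n
    ≡⟨ ⊛-cong n (λ _ _ → refl) (λ k _ → ⊛-linearʳ (f 0) pows (g ∘ suc) ((f ∘ suc) ⊛ g) k) ⟩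
  (ones ⊛ (λ k → f 0 * (pows ⊛ (g ∘ suc)) k + (pows ⊛ ((f ∘ suc) ⊛ g)) k)) n
    ≡⟨ ⊛-linearʳ (f 0) ones (pows ⊛ (g ∘ suc)) (pows ⊛ ((f ∘ suc) ⊛ g)) n ⟩
  f 0 * step g n + (ones ⊛ (pows ⊛ ((f ∘ suc) ⊛ g))) n
    ≡⟨ cong (f 0 * step g n +_) (⊛-cong n (λ _ _ → refl) (λ k _ → sym (⊛-assoc pows (f ∘ suc) g k))) ⟩
  f 0 * step g n + (ones ⊛ ((pows ⊛ (f ∘ suc)) ⊛ g)) n
    ≡⟨ cong (f 0 * step g n +_) (⊛-assoc ones (pows ⊛ (f ∘ suc)) g n) ⟨
  f 0 * step g n + (step f ⊛ g) n ∎

-- The recursion changes the weight instead of the vector of counts, so `step` is the transpose of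
-- the production matrix. The sum over the two parts of a graph is already merged into `step`;
-- `total-⊛` recovers it.
total : ℕ → (ℕ → ℕ) → ℕ
total zero    f = f 0
total (suc m) f = total m (step f)

total-cong : ∀ m {f g} → (∀ a → a ≤ m → f a ≡ g a) → total m f ≡ total m g
total-cong zero    p = p 0 z≤n
total-cong (suc m) {f} {g} p = total-cong m λ a a≤m → step-cong f g a λ b b≤a → p (suc b) (s≤s (≤-trans b≤a a≤m))

total-linear : ∀ m c f g → total m (λ k → c * f k + g k) ≡ c * total m f + total m g
total-linear zero    c f g = refl
total-linear (suc m) c f g = trans (total-cong m (λ a _ → step-linear c f g a))
  (total-linear m c (step f) (step g))

total-zero : ∀ m → total m (λ _ → 0) ≡ 0
total-zero m = +-cancelˡ-≡ _ (total m (λ _ → 0)) 0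
  (trans (trans (cong (_+ total m (λ _ → 0)) (sym (*-identityˡ _))) (sym (total-linear m 1 (λ _ → 0) (λ _ → 0)))) (sym (+-identityʳ _)))

-- No edge passes over a visible vertex, so cutting there leaves two connected graphs sharing that
-- vertex; in `f ⊛ g`, a splitting i + j of the number of arches chooses visible vertex number i for
-- the cut. Algebraically, the two terms of `step-⊛` match the two terms of the convolution at
-- `suc m`.
total-⊛ : ∀ m f g → ((λ k → total k f) ⊛ (λ k → total k g)) m ≡ total m (f ⊛ g)
total-⊛ zero    f g = refl
total-⊛ (suc m) f g = begin
  f 0 * total m (step g) + ((λ k → total k (step f)) ⊛ (λ k → total k g)) m
    ≡⟨ cong (f 0 * total m (step g) +_) (total-⊛ m (step f) g) ⟩
  f 0 * total m (step g) + total m (step f ⊛ g)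
    ≡⟨ total-linear m (f 0) (step g) (step f ⊛ g) ⟨
  total m (λ k → f 0 * step g k + (step f ⊛ g) k)
    ≡⟨ total-cong m (λ k _ → sym (step-⊛ f g k)) ⟩
  total m (step (f ⊛ g)) ∎

total-sum : ∀ m {n} (w : Fin n → ℕ) (f : Fin n → ℕ → ℕ) →
            total m (λ a → sum (λ q → w q * f q a)) ≡ sum (λ q → w q * total m (f q))
total-sum m {zero}  w f = total-zero m
total-sum m {suc n} w f = trans
  (total-linear m (w zero) (f zero) (λ a → sum (λ q → w (suc q) * f (suc q) a)))
  (cong (w zero * total m (f zero) +_) (total-sum m (w ∘ suc) (f ∘ suc)))

sum-zero : ∀ {n} (w : Fin n → ℕ) → sum (λ q → w q * 0) ≡ 0
sum-zero {zero}  w = refl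
sum-zero {suc n} w = cong₂ _+_ (*-zeroʳ (w zero)) (sum-zero (w ∘ suc))

sum-δ : ∀ {n} (w : ℕ → ℕ) {a} → a < n → sum {n} (λ q → w (toℕ q) * δ (toℕ q) a) ≡ w a
sum-δ {suc n} w {zero}  _         =
  trans (cong₂ _+_ (*-identityʳ (w 0)) (sum-zero (λ q → w (suc (toℕ {n} q))))) (+-identityʳ (w 0))
sum-δ {suc n} w {suc a} (s≤s a<n) =
  trans (cong (_+ sum {n} (λ q → w (suc (toℕ q)) * δ (toℕ q) a)) (*-zeroʳ (w 0))) (sum-δ (w ∘ suc) a<n)

-- Row r and column q stand for r + 1 and q + 1 arches. The `suc` in `step` turns `δ (suc r)` into
-- `δ r`, and convolving with it shifts `ones ⊛ pows` by r: the entry is the value at q + 1 - r, or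
-- 0 if q + 1 < r.
C-entry : ∀ n (r q : Fin n) → C n r q ≡ step (δ (suc (toℕ r))) (suc (toℕ q))
C-entry n r q with toℕ r ≤ᵇ suc (toℕ q) in eq
... | true = sym (begin
  step (δ (suc p)) (suc k)               ≡⟨ ⊛-assoc ones pows (δ p) (suc k) ⟨
  ((ones ⊛ pows) ⊛ δ p) (suc k)          ≡⟨ ⊛-δ-≤ (ones ⊛ pows) p≤k ⟩
  (ones ⊛ pows) (suc k ∸ p)              ≡⟨ ones⊛pows (suc k ∸ p) ⟩
  2 ^ suc (suc k ∸ p) ∸ 1                ≡⟨ cong (λ e → 2 ^ e ∸ 1) (+-∸-assoc 1 p≤k) ⟨
  2 ^ (suc (suc k) ∸ p) ∸ 1              ≡⟨ cong (λ e → 2 ^ (e ∸ p) ∸ 1) (+-comm 2 k) ⟩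
  2 ^ (k + 2 ∸ p) ∸ 1                    ∎)
  where
  p = toℕ r
  k = toℕ q
  p≤k : p ≤ suc k
  p≤k = ≤ᵇ⇒≤ p (suc k) (subst T (sym eq) _)
... | false = sym (trans (sym (⊛-assoc ones pows (δ (toℕ r)) (suc (toℕ q))))
  (⊛-δ-> (ones ⊛ pows) {toℕ r} {suc (toℕ q)} (≰⇒> λ le → subst T eq (≤⇒≤ᵇ le))))

total-recurrence : ∀ m n → suc m ≤ n → (r : Fin n) →
                   total (suc (suc m)) (δ (suc (toℕ r))) ≡ (C n *ᵥ λ q → total (suc m) (δ (suc (toℕ q)))) r
total-recurrence m n m<n r = begin
  total m (step f)
    -- `total (suc m)` reads its weight only at 1, ..., m + 1, the possible numbers of arches on m +
    -- 2 points. There, as m < n, the weight agrees with its expansion in the indicators of 1, ...,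
    -- n.
    ≡⟨ total-cong m (λ a a≤m → step-cong f (λ a → sum {n} (λ q → f (suc (toℕ q)) * δ (suc (toℕ q)) a)) a λ b b≤a →
         sym (sum-δ (λ k → f (suc k)) (≤-<-trans (≤-trans b≤a a≤m) m<n))) ⟩
  total (suc m) (λ a → sum {n} (λ q → f (suc (toℕ q)) * δ (suc (toℕ q)) a))
    ≡⟨ total-sum (suc m) (λ q → f (suc (toℕ q))) (λ (q : Fin n) → δ (suc (toℕ q))) ⟩
  sum {n} (λ q → f (suc (toℕ q)) * total (suc m) (δ (suc (toℕ q))))
    ≡⟨ sum-cong-≗ {n} (λ q → cong (_* total (suc m) (δ (suc (toℕ q)))) (sym (C-entry n r q))) ⟩
  sum {n} (λ q → C n r q * total (suc m) (δ (suc (toℕ q)))) ∎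
  where
  f = step (δ (suc (toℕ r)))

-- Codes of connected plane graphs

-- Code l r a encodes the connected plane graphs on the points l, …, r with a
-- arches.  In a node, r is joined to the visible vertex number p of the first
-- part and to those of numbers p + 1, …, p + e that are selected by the bits.
data Code : ℕ → ℕ → ℕ → Set where
  leaf : ∀ {l} → Code l l 0
  node : ∀ {l k r a₁ a₂ p e} → Code l k a₁ → Code (suc k) r a₂ →
         e + p ≡ a₁ → Vec Bool e → Code l r (suc p)

Code-≤ : ∀ {l r a} → Code l r a → l ≤ r
Code-≤ leaf               = ≤-refl
Code-≤ (node g₁ g₂ _ _) = ≤-trans (Code-≤ g₁) (<⇒≤ (Code-≤ g₂))

-- Counting codes

Fin-×-↔ : ∀ {A B : Set} {m n} → Fin m ↔ A → Fin n ↔ B → Fin (m * n) ↔ (A × B)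
Fin-×-↔ f g = ↔-trans Fin.*↔× (f ×-↔ g)

Fin-⊎-↔ : ∀ {A B : Set} {m n} → Fin m ↔ A → Fin n ↔ B → Fin (m + n) ↔ (A ⊎ B)
Fin-⊎-↔ f g = ↔-trans Fin.+↔⊎ (f ⊎-↔ g)

Fin-Vec-↔ : ∀ n → Fin (2 ^ n) ↔ Vec Bool n
Fin-Vec-↔ zero    = mk↔ₛ′ (λ _ → []) (λ _ → zero) (λ { [] → refl }) (λ { zero → refl })
Fin-Vec-↔ (suc n) = ↔-trans (Fin-⊎-↔ (Fin-Vec-↔ n) (Fin-⊎-↔ (Fin-Vec-↔ n) Fin.0↔⊥)) split
  where
  split : (Vec Bool n ⊎ (Vec Bool n ⊎ ⊥)) ↔ Vec Bool (suc n)
  split = mk↔ₛ′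
    (λ { (inj₁ v) → false ∷ v ; (inj₂ (inj₁ v)) → true ∷ v })
    (λ { (false ∷ v) → inj₁ v ; (true ∷ v) → inj₂ (inj₁ v) })
    (λ { (false ∷ v) → refl ; (true ∷ v) → refl })
    (λ { (inj₁ v) → refl ; (inj₂ (inj₁ v)) → refl })

Conv : (ℕ → ℕ → Set) → ℕ → Set
Conv R n = ∃ λ x → ∃ λ y → x + y ≡ n × R x y

Fin-Conv-↔ : ∀ {R : ℕ → ℕ → Set} {f g} n → (∀ x y → x + y ≡ n → Fin (f x * g y) ↔ R x y) →
             Fin ((f ⊛ g) n) ↔ Conv R n
Fin-Conv-↔ zero φ = ↔-trans (φ 0 0 refl) (mk↔ₛ′
  (λ c → 0 , 0 , refl , c)
  (λ { (0 , 0 , refl , c) → c })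
  (λ { (0 , 0 , refl , c) → refl })
  (λ _ → refl))
Fin-Conv-↔ {R} (suc n) φ = ↔-trans
  (Fin-⊎-↔ (φ 0 (suc n) refl) (Fin-Conv-↔ {R ∘ suc} n (λ x y eq → φ (suc x) y (cong suc eq))))
  (mk↔ₛ′
    (λ { (inj₁ c) → 0 , suc n , refl , c
       ; (inj₂ (x , y , refl , c)) → suc x , y , refl , c })
    (λ { (0 , .(suc n) , refl , c) → inj₁ c
       ; (suc x , y , refl , c) → inj₂ (x , y , refl , c) })
    (λ { (0 , .(suc n) , refl , c) → refl
       ; (suc x , y , refl , c) → refl })
    (λ { (inj₁ c) → refl
       ; (inj₂ (x , y , refl , c)) → refl }))

-- A weight f is represented by sets `B a` with f a elements, which turns a weighted sum into the
-- size of a set and its recurrence into a bijection.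
Weighted : (ℕ → Set) → ℕ → ℕ → Set
Weighted B l r = ∃ λ a → Code l r a × B a

Branch : (ℕ → Set) → ℕ → Set
Branch B = Conv (λ e p → Vec Bool e × B (suc p))

Fin-Branch-↔ : ∀ {B : ℕ → Set} {f} → (∀ a → Fin (f a) ↔ B a) → ∀ a → Fin ((pows ⊛ (f ∘ suc)) a) ↔ Branch B a
Fin-Branch-↔ φ a = Fin-Conv-↔ a (λ e p _ → Fin-×-↔ (Fin-Vec-↔ e) (φ (suc p)))

module Unfold (B : ℕ → Set) (l m : ℕ) where

  Parts : Set
  Parts = Conv (λ m₂ m₁ → Weighted (λ _ → ⊤) (suc (m₁ + l)) (m₂ + suc (m₁ + l)) ×
                          Weighted (Branch B) l (m₁ + l)) m

  join : ∀ {k r} → r ≡ suc (m + l) → Weighted (λ _ → ⊤) (suc k) r → Weighted (Branch B) l k →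
         Weighted B l (suc (m + l))
  join refl (a₂ , g₂ , _) (a₁ , g₁ , e , p , eq , Y , b) = suc p , node g₁ g₂ eq Y , b

  split : ∀ {k r} m₁ m₂ → m₁ + l ≡ k → m₂ + suc k ≡ r → r ≡ suc (m + l) →
          Weighted (λ _ → ⊤) (suc k) r → Weighted (Branch B) l k → Parts
  split m₁ m₂ refl refl eq w₂ w₁ = m₂ , m₁ , sizes , w₂ , w₁
    where
    sizes : m₂ + m₁ ≡ m
    sizes = +-cancelʳ-≡ (suc l) _ _ (trans (trans (+-assoc m₂ m₁ (suc l)) (cong (m₂ +_) (+-suc m₁ l)))
              (trans eq (sym (+-suc m l))))

  sizes⇒end : ∀ m₁ m₂ → m₂ + m₁ ≡ m → m₂ + suc (m₁ + l) ≡ suc (m + l)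
  sizes⇒end m₁ m₂ refl = trans (+-suc m₂ (m₁ + l)) (cong suc (sym (+-assoc m₂ m₁ l)))

  to : Parts → Weighted B l (suc (m + l))
  to (m₂ , m₁ , eq , w₂ , w₁) = join (sizes⇒end m₁ m₂ eq) w₂ w₁

  -- Matching on a code needs a variable right end: against `suc (m + l)`, the case `leaf` would ask
  -- to unify this with `l`. Hence the separate equation here and the `subst` in `to∘from`.
  from : ∀ {r} → r ≡ suc (m + l) → Weighted B l r → Parts
  from eq (_ , leaf , _) = contradiction eq (m≢1+n+m _)
  from {r} eq (_ , node {k = k} {p = p} {e} g₁ g₂ eq′ Y , b) =
    split (k ∸ l) (r ∸ suc k) (m∸n+n≡m (Code-≤ g₁)) (m∸n+n≡m (Code-≤ g₂)) eq
      (_ , g₂ , tt) (_ , g₁ , e , p , eq′ , Y , b)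

  to-split : ∀ {k r} m₁ m₂ (q₁ : m₁ + l ≡ k) (q₂ : m₂ + suc k ≡ r) (q₃ : r ≡ suc (m + l)) w₂ w₁ →
             to (split m₁ m₂ q₁ q₂ q₃ w₂ w₁) ≡ join q₃ w₂ w₁
  to-split m₁ m₂ refl refl q₃ w₂ w₁ = cong (λ q → join q w₂ w₁) (≡-irrelevant _ q₃)

  to∘from : ∀ {r} (q : r ≡ suc (m + l)) w → to (from q w) ≡ subst (Weighted B l) q w
  to∘from q (_ , leaf , _) = contradiction q (m≢1+n+m _)
  to∘from {r} q (_ , node {k = k} g₁ g₂ _ _ , _) =
    trans (to-split (k ∸ l) (r ∸ suc k) (m∸n+n≡m (Code-≤ g₁)) (m∸n+n≡m (Code-≤ g₂)) q _ _) (join-subst q)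
    where
    join-subst : ∀ {r} (q : r ≡ suc (m + l)) {k a₂ a₁ e p} {g₂ : Code (suc k) r a₂} {g₁ : Code l k a₁}
                 {eq : e + p ≡ a₁} {Y : Vec Bool e} {b : B (suc p)} →
                 join q (a₂ , g₂ , tt) (a₁ , g₁ , e , p , eq , Y , b) ≡
                 subst (Weighted B l) q (suc p , node g₁ g₂ eq Y , b)
    join-subst refl = refl

  split-unique : ∀ m₁ m₂ m₁′ m₂′ (q₁ : m₁′ + l ≡ m₁ + l) (q₂ : m₂′ + suc (m₁ + l) ≡ m₂ + suc (m₁ + l))
                 q₃ w₂ w₁ (eq : m₂ + m₁ ≡ m) →
                 split m₁′ m₂′ q₁ q₂ q₃ w₂ w₁ ≡ (m₂ , m₁ , eq , w₂ , w₁)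
  split-unique m₁ m₂ m₁′ m₂′ q₁ q₂ q₃ w₂ w₁ eq
    with refl ← +-cancelʳ-≡ l m₁′ m₁ q₁ | refl ← +-cancelʳ-≡ (suc (m₁ + l)) m₂′ m₂ q₂
    with refl ← ≡-irrelevant q₁ refl | refl ← ≡-irrelevant q₂ refl =
    cong (λ eq → m₂ , m₁ , eq , w₂ , w₁) (≡-irrelevant _ eq)

  from-join : ∀ {k r} (q : r ≡ suc (m + l)) (w₂ : Weighted (λ _ → ⊤) (suc k) r) (w₁ : Weighted (Branch B) l k) →
              from refl (join q w₂ w₁) ≡
              split (k ∸ l) (r ∸ suc k) (m∸n+n≡m (Code-≤ (proj₁ (proj₂ w₁))))
                    (m∸n+n≡m (Code-≤ (proj₁ (proj₂ w₂)))) q w₂ w₁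
  from-join refl w₂ w₁ = refl

  from∘to : ∀ x → from refl (to x) ≡ x
  from∘to (m₂ , m₁ , eq , w₂ , w₁) = trans (from-join (sizes⇒end m₁ m₂ eq) w₂ w₁)
    (split-unique m₁ m₂ _ _ _ _ _ w₂ w₁ eq)

  Parts-↔ : Parts ↔ Weighted B l (suc (m + l))
  Parts-↔ = mk↔ₛ′ to (from refl) (to∘from refl) from∘to

-- The recursion goes to both sizes `m₂` and `m₁` of a splitting of `m`, which are not structurally
-- smaller; `n` is the bound that decreases.
Fin-Weighted-↔ : ∀ n m → m < n → ∀ l {B : ℕ → Set} {f} → (∀ a → Fin (f a) ↔ B a) →
                 Fin (total m f) ↔ Weighted B l (m + l)
Fin-Weighted-↔ (suc n) zero    _         l {B} {f} φ = ↔-trans (φ 0) (mk↔ₛ′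
  (λ b → 0 , leaf , b)
  (from refl)
  (to∘from refl)
  (λ _ → refl))
  where
  from : ∀ {r} → r ≡ l → Weighted B l r → B 0
  from eq (_ , leaf , b)           = b
  from eq (_ , node g₁ g₂ _ _ , _) = contradiction eq (>⇒≢ (≤-<-trans (Code-≤ g₁) (Code-≤ g₂)))
  to∘from : ∀ {r} (eq : r ≡ l) (w : Weighted B l r) → (0 , leaf , from eq w) ≡ subst (Weighted B l) eq w
  to∘from refl (_ , leaf , b)         = refl
  to∘from eq (_ , node g₁ g₂ _ _ , _) = contradiction eq (>⇒≢ (≤-<-trans (Code-≤ g₁) (Code-≤ g₂)))
Fin-Weighted-↔ (suc n) (suc m) (s≤s m<n) l {B} {f} φ =
  subst (λ k → Fin k ↔ Weighted B l (suc m + l)) (total-⊛ m ones (pows ⊛ (f ∘ suc)))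
    (↔-trans (Fin-Conv-↔ m part) (Unfold.Parts-↔ B l m))
  where
  part : ∀ m₂ m₁ → m₂ + m₁ ≡ m →
         Fin (total m₂ ones * total m₁ (pows ⊛ (f ∘ suc))) ↔
         (Weighted (λ _ → ⊤) (suc (m₁ + l)) (m₂ + suc (m₁ + l)) × Weighted (Branch B) l (m₁ + l))
  part m₂ m₁ refl = Fin-×-↔
    (Fin-Weighted-↔ n m₂ (≤-<-trans (m≤m+n m₂ m₁) m<n) (suc (m₁ + l)) (λ _ → Fin.1↔⊤))
    (Fin-Weighted-↔ n m₁ (≤-<-trans (m≤n+m m₁ m₂) m<n) l (Fin-Branch-↔ φ))

Fin-δ-↔ : ∀ p a → Fin (δ p a) ↔ (p ≡ a)
Fin-δ-↔ zero    zero    = mk↔ₛ′ (λ _ → refl) (λ _ → zero) (λ { refl → refl }) (λ { zero → refl })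
Fin-δ-↔ zero    (suc _) = mk↔ₛ′ (λ ()) (λ ()) (λ ()) (λ ())
Fin-δ-↔ (suc _) zero    = mk↔ₛ′ (λ ()) (λ ()) (λ ()) (λ ())
Fin-δ-↔ (suc p) (suc a) = ↔-trans (Fin-δ-↔ p a)
  (mk↔ₛ′ (cong suc) suc-injective (λ _ → ≡-irrelevant _ _) (λ _ → ≡-irrelevant _ _))

Fin-Code-↔ : ∀ m a → Fin (total m (δ a)) ↔ Code 0 m a
Fin-Code-↔ m a = subst (λ r → Fin (total m (δ a)) ↔ Code 0 r a) (+-identityʳ m)
  (↔-trans (Fin-Weighted-↔ (suc m) m ≤-refl 0 (Fin-δ-↔ a)) (mk↔ₛ′
    (λ { (_ , g , refl) → g }) (λ g → a , g , refl) (λ _ → refl) (λ { (_ , g , refl) → refl })))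

-- Visible vertices and edges of a code

bit : ∀ {e} → Vec Bool e → ℕ → Bool
bit []      _       = false
bit (b ∷ _) zero    = b
bit (_ ∷ Y) (suc j) = bit Y j

bit-< : ∀ {e} (Y : Vec Bool e) j → bit Y j ≡ true → j < e
bit-< (_ ∷ Y) zero    _  = s≤s z≤n
bit-< (_ ∷ Y) (suc j) eq = s≤s (bit-< Y j eq)

bit-ext : ∀ {e} (Y Z : Vec Bool e) → (∀ j → bit Y j ≡ bit Z j) → Y ≡ Z
bit-ext []      []      _ = refl
bit-ext (_ ∷ Y) (_ ∷ Z) p = cong₂ _∷_ (p 0) (bit-ext Y Z (p ∘ suc))

-- The visible vertices are the values at j ≤ a.
vis : ∀ {l r a} → Code l r a → ℕ → ℕ
vis {l} leaf _ = l
vis {r = r} (node {p = p} g₁ _ _ _) j = if does (j ≤? p) then vis g₁ j else r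

module _ {l k r a₁ a₂ p e} (g₁ : Code l k a₁) (g₂ : Code (suc k) r a₂) (eq : e + p ≡ a₁) (Y : Vec Bool e) where

  vis-≤ : ∀ {j} → j ≤ p → vis (node g₁ g₂ eq Y) j ≡ vis g₁ j
  vis-≤ {j} j≤p rewrite dec-true (j ≤? p) j≤p = refl

  vis-> : ∀ {j} → p < j → vis (node g₁ g₂ eq Y) j ≡ r
  vis-> {j} p<j rewrite dec-false (j ≤? p) (<⇒≱ p<j) = refl

-- The bit prefixed in `true ∷ Y` stands for the obligatory neighbour number `p` of `r`, so that bit
-- `j` belongs to visible vertex number `j + p` and all spokes have one form.
data Edge : ∀ {l r a} → Code l r a → ℕ → ℕ → Set where
  inˡ   : ∀ {l k r a₁ a₂ p e} {g₁ : Code l k a₁} {g₂ : Code (suc k) r a₂} {eq : e + p ≡ a₁} {Y : Vec Bool e} {x y} →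
          Edge g₁ x y → Edge (node g₁ g₂ eq Y) x y
  inʳ   : ∀ {l k r a₁ a₂ p e} {g₁ : Code l k a₁} {g₂ : Code (suc k) r a₂} {eq : e + p ≡ a₁} {Y : Vec Bool e} {x y} →
          Edge g₂ x y → Edge (node g₁ g₂ eq Y) x y
  spoke : ∀ {l k r a₁ a₂ p e} {g₁ : Code l k a₁} {g₂ : Code (suc k) r a₂} {eq : e + p ≡ a₁} {Y : Vec Bool e} →
          ∀ j → bit (true ∷ Y) j ≡ true → Edge (node g₁ g₂ eq Y) (vis g₁ (j + p)) r

vis-lower : ∀ {l r a} (g : Code l r a) j → l ≤ vis g j
vis-lower leaf j = ≤-refl
vis-lower (node {p = p} g₁ g₂ _ _) j with does (j ≤? p)
... | true  = vis-lower g₁ j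
... | false = ≤-trans (Code-≤ g₁) (<⇒≤ (Code-≤ g₂))

vis-upper : ∀ {l r a} (g : Code l r a) j → vis g j ≤ r
vis-upper leaf j = ≤-refl
vis-upper (node {p = p} g₁ g₂ _ _) j with does (j ≤? p)
... | true  = ≤-trans (vis-upper g₁ j) (<⇒≤ (Code-≤ g₂))
... | false = ≤-refl

summand-≤ : ∀ {e p a} → e + p ≡ a → p ≤ a
summand-≤ {e} refl = m≤n+m _ e

vis-mono-< : ∀ {l r a} (g : Code l r a) {i j} → i < j → j ≤ a → vis g i < vis g j
vis-mono-< leaf () z≤n
vis-mono-< (node {p = p} g₁ g₂ eq Y) {i} {j} i<j j≤sp with m≤n⇒m<n∨m≡n j≤sp
... | inj₁ (s≤s j≤p)
  rewrite vis-≤ g₁ g₂ eq Y j≤p | vis-≤ g₁ g₂ eq Y (≤-trans (<⇒≤ i<j) j≤p) =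
  vis-mono-< g₁ i<j (≤-trans j≤p (summand-≤ eq))
... | inj₂ refl
  rewrite vis-> g₁ g₂ eq Y (n<1+n p) | vis-≤ g₁ g₂ eq Y (s≤s⁻¹ i<j) =
  ≤-<-trans (vis-upper g₁ i) (Code-≤ g₂)

vis-mono-≤ : ∀ {l r a} (g : Code l r a) {i j} → i ≤ j → j ≤ a → vis g i ≤ vis g j
vis-mono-≤ g i≤j j≤a with m≤n⇒m<n∨m≡n i≤j
... | inj₁ i<j  = <⇒≤ (vis-mono-< g i<j j≤a)
... | inj₂ refl = ≤-refl

vis-cancel-≤ : ∀ {l r a} (g : Code l r a) {i j} → i ≤ a → vis g i ≤ vis g j → i ≤ j
vis-cancel-≤ g i≤a le = ≮⇒≥ λ j<i → <⇒≱ (vis-mono-< g j<i i≤a) le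

vis-injective : ∀ {l r a} (g : Code l r a) {i j} → i ≤ a → j ≤ a → vis g i ≡ vis g j → i ≡ j
vis-injective g i≤a j≤a eq = ≤-antisym (vis-cancel-≤ g i≤a (≤-reflexive eq)) (vis-cancel-≤ g j≤a (≤-reflexive (sym eq)))

spoke-bound : ∀ {e p a₁} (Y : Vec Bool e) {j} → e + p ≡ a₁ → bit (true ∷ Y) j ≡ true → j + p ≤ a₁
spoke-bound {e} {p} Y refl eq = +-monoˡ-≤ p (s≤s⁻¹ (bit-< (true ∷ Y) _ eq))

vis-spoke-≤ : ∀ {l r a} (g : Code l r a) {e p} (Y : Vec Bool e) {j} → e + p ≡ a → bit (true ∷ Y) j ≡ true →
              vis g p ≤ vis g (j + p)
vis-spoke-≤ g {p = p} Y {j} eq b = vis-mono-≤ g (m≤n+m p j) (spoke-bound Y eq b)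

Edge-lower : ∀ {l r a} {g : Code l r a} {x y} → Edge g x y → l ≤ x
Edge-lower (inˡ E)                  = Edge-lower E
Edge-lower (inʳ {g₁ = g₁} E)        = ≤-trans (Code-≤ g₁) (<⇒≤ (Edge-lower E))
Edge-lower (spoke {g₁ = g₁} j _)    = vis-lower g₁ _

Edge-upper : ∀ {l r a} {g : Code l r a} {x y} → Edge g x y → y ≤ r
Edge-upper (inˡ {g₂ = g₂} E) = ≤-trans (Edge-upper E) (<⇒≤ (Code-≤ g₂))
Edge-upper (inʳ E)           = Edge-upper E
Edge-upper (spoke j _)       = ≤-refl

Edge-< : ∀ {l r a} {g : Code l r a} {x y} → Edge g x y → x < y
Edge-< (inˡ E)                       = Edge-< E
Edge-< (inʳ E)                       = Edge-< E
Edge-< (spoke {g₁ = g₁} {g₂} j _)    = ≤-<-trans (vis-upper g₁ _) (Code-≤ g₂)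

Hidden : (ℕ → ℕ → Set) → ℕ → Set
Hidden E x = ∃ λ u → ∃ λ v → u < x × x < v × E u v

vis-visible : ∀ {l r a} (g : Code l r a) j → ¬ Hidden (Edge g) (vis g j)
vis-visible leaf j (_ , _ , _ , _ , ())
vis-visible {l} {r} (node {p = p} g₁ g₂ eq Y) j hidden with j ≤? p
... | no j≰p with _ , _ , _ , x<v , E ← subst (Hidden (Edge (node g₁ g₂ eq Y))) (vis-> g₁ g₂ eq Y (≰⇒> j≰p)) hidden =
  <⇒≱ x<v (Edge-upper E)
... | yes j≤p = absurd (subst (Hidden (Edge (node g₁ g₂ eq Y))) (vis-≤ g₁ g₂ eq Y j≤p) hidden)
  where
  absurd : ¬ Hidden (Edge (node g₁ g₂ eq Y)) (vis g₁ j)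
  absurd (u , v , u<x , x<v , inˡ E)     = vis-visible g₁ j (u , v , u<x , x<v , E)
  absurd (u , v , u<x , x<v , inʳ E)     = <⇒≱ (<-trans (Edge-lower E) u<x) (vis-upper g₁ j)
  absurd (_ , _ , u<x , x<v , spoke i b) =
    <⇒≱ u<x (≤-trans (vis-mono-≤ g₁ j≤p (summand-≤ eq)) (vis-spoke-≤ g₁ Y eq b))

-- The spoke from visible vertex number `p` passes over everything strictly between that vertex and
-- `r`, which includes the whole second part. To its left, an unhidden vertex was already visible in
-- the first part.
vis-complete : ∀ {l r a} (g : Code l r a) {x} → l ≤ x → x ≤ r → ¬ Hidden (Edge g) x →
               ∃ λ j → j ≤ a × x ≡ vis g j
vis-complete leaf l≤x x≤l _ = 0 , z≤n , ≤-antisym x≤l l≤x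
vis-complete (node {r = r} {p = p} g₁ g₂ eq Y) {x} l≤x x≤r exposed with m≤n⇒m<n∨m≡n x≤r
... | inj₂ refl = suc p , ≤-refl , sym (vis-> g₁ g₂ eq Y (n<1+n p))
... | inj₁ x<r with x ≤? vis g₁ p
...   | no x≰ = contradiction (_ , _ , ≰⇒> x≰ , x<r , spoke 0 refl) exposed
...   | yes x≤ with vis-complete g₁ l≤x (≤-trans x≤ (vis-upper g₁ p))
                    (λ { (u , v , u<x , x<v , E) → exposed (u , v , u<x , x<v , inˡ E) })
...     | j , j≤a₁ , refl with vis-cancel-≤ g₁ j≤a₁ x≤
...       | j≤p = j , m≤n⇒m≤1+n j≤p , sym (vis-≤ g₁ g₂ eq Y j≤p)

Noncrossing : (ℕ → ℕ → Set) → Set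
Noncrossing E = ∀ {a b c d} → a < b → b < c → c < d → E a c → E b d → ⊥

-- A spoke ends at `r`, so as the edge ac it leaves no room for d. As the edge bd it starts at a
-- visible vertex of the first part, over which no edge of that part passes.
Edge-noncrossing : ∀ {l r a} (g : Code l r a) → Noncrossing (Edge g)
Edge-noncrossing (node g₁ g₂ eq Y) a<b b<c c<d (inˡ E)     (inˡ E′)    = Edge-noncrossing g₁ a<b b<c c<d E E′
Edge-noncrossing (node g₁ g₂ eq Y) a<b b<c c<d (inˡ E)     (inʳ E′)    = <-asym (<-≤-trans b<c (Edge-upper E)) (Edge-lower E′)
Edge-noncrossing (node g₁ g₂ eq Y) a<b b<c c<d (inˡ E)     (spoke j _) = vis-visible g₁ _ (_ , _ , a<b , b<c , E)
Edge-noncrossing (node g₁ g₂ eq Y) a<b b<c c<d (inʳ E)     (inˡ E′)    =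
  <-asym (Edge-lower E) (<-≤-trans (<-trans a<b (<-trans b<c c<d)) (Edge-upper E′))
Edge-noncrossing (node g₁ g₂ eq Y) a<b b<c c<d (inʳ E)     (inʳ E′)    = Edge-noncrossing g₂ a<b b<c c<d E E′
Edge-noncrossing (node g₁ g₂ eq Y) a<b b<c c<d (inʳ E)     (spoke j _) = <-asym (Edge-lower E) (<-≤-trans a<b (vis-upper g₁ _))
Edge-noncrossing (node g₁ g₂ eq Y) a<b b<c c<d (spoke i _) E′          = <⇒≱ c<d (Edge-upper E′)

-- An arbitrary equivalence relation covers both uses: having the same colour in `split-≮`, and
-- being joined by a path in `toGraph-connected`.
Edge-connected : ∀ {l r a} (g : Code l r a) {ℓ} {_∼_ : Rel ℕ ℓ} → IsEquivalence _∼_ →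
                 (∀ {x y} → Edge g x y → x ∼ y) → ∀ {x} → l ≤ x → x ≤ r → x ∼ l
Edge-connected leaf {_∼_ = _∼_} ∼-eq _ {x} l≤x x≤l with refl ← ≤-antisym l≤x x≤l = IsEquivalence.refl ∼-eq
Edge-connected (node {k = k} {r} {p = p} g₁ g₂ eq Y) {_∼_ = _∼_} ∼-eq ⊆∼ {x} l≤x x≤r with x ≤? k
... | yes x≤k = Edge-connected g₁ ∼-eq (⊆∼ ∘ inˡ) l≤x x≤k
... | no x≰k  = ∼-trans (right (≰⇒> x≰k) x≤r) (∼-trans (∼-sym (right (Code-≤ g₂) ≤-refl))
    (∼-trans (∼-sym (⊆∼ (spoke 0 refl))) (Edge-connected g₁ ∼-eq (⊆∼ ∘ inˡ) (vis-lower g₁ p) (vis-upper g₁ p))))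
  where
  open IsEquivalence ∼-eq using () renaming (trans to ∼-trans; sym to ∼-sym)
  right : ∀ {x} → suc k ≤ x → x ≤ r → x ∼ suc k
  right = Edge-connected g₂ ∼-eq (⊆∼ ∘ inʳ)

Edge? : ∀ {l r a} (g : Code l r a) x y → Dec (Edge g x y)
Edge? leaf x y = no λ ()
Edge? {l} {r} (node {p = p} {e} g₁ g₂ eq Y) x y =
  map′ (λ { (inj₁ E) → inˡ E
          ; (inj₂ (inj₁ E)) → inʳ E
          ; (inj₂ (inj₂ (refl , j , _ , b , refl))) → spoke j b })
       (λ { (inˡ E) → inj₁ E
          ; (inʳ E) → inj₂ (inj₁ E)
          ; (spoke j b) → inj₂ (inj₂ (refl , j , bit-< (true ∷ Y) j b , b , refl)) })
  (Edge? g₁ x y ⊎-dec Edge? g₂ x y ⊎-dec ((y ≟ r) ×-dec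
    anyUpTo? (λ j → (bit (true ∷ Y) j Bool.≟ true) ×-dec (x ≟ vis g₁ (j + p))) (suc e)))

module _ {l k r a₁ a₂ p e} {g₁ : Code l k a₁} {g₂ : Code (suc k) r a₂} {eq : e + p ≡ a₁} {Y : Vec Bool e} where

  inˡ⁻¹ : ∀ {x y} → y ≤ k → Edge (node g₁ g₂ eq Y) x y → Edge g₁ x y
  inˡ⁻¹ y≤k (inˡ E)     = E
  inˡ⁻¹ y≤k (inʳ E)     = contradiction (≤-trans (<⇒≤ (Edge-< E)) y≤k) (<⇒≱ (Edge-lower E))
  inˡ⁻¹ y≤k (spoke _ _) = contradiction y≤k (<⇒≱ (Code-≤ g₂))

  inʳ⁻¹ : ∀ {x y} → k < x → Edge (node g₁ g₂ eq Y) x y → Edge g₂ x y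
  inʳ⁻¹ k<x (inˡ E)     = contradiction (≤-trans (<⇒≤ (Edge-< E)) (Edge-upper E)) (<⇒≱ k<x)
  inʳ⁻¹ k<x (inʳ E)     = E
  inʳ⁻¹ k<x (spoke _ _) = contradiction (vis-upper g₁ _) (<⇒≱ k<x)

  spoke⁻¹ : ∀ {x y} → x ≤ k → k < y → Edge (node g₁ g₂ eq Y) x y →
            ∃ λ j → bit (true ∷ Y) j ≡ true × x ≡ vis g₁ (j + p)
  spoke⁻¹ x≤k k<y (inˡ E)     = contradiction (Edge-upper E) (<⇒≱ k<y)
  spoke⁻¹ x≤k k<y (inʳ E)     = contradiction x≤k (<⇒≱ (Edge-lower E))
  spoke⁻¹ x≤k k<y (spoke j b) = j , b , refl

  crossing⇒end : ∀ {x y} → x ≤ k → k < y → Edge (node g₁ g₂ eq Y) x y → y ≡ r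
  crossing⇒end x≤k k<y (inˡ E)     = contradiction (Edge-upper E) (<⇒≱ k<y)
  crossing⇒end x≤k k<y (inʳ E)     = contradiction x≤k (<⇒≱ (Edge-lower E))
  crossing⇒end x≤k k<y (spoke j b) = refl

-- Codes are determined by their edges

infix 4 _⊑_
_⊑_ : ∀ {l r a l′ r′ a′} → Code l r a → Code l′ r′ a′ → Set
g ⊑ g′ = ∀ {x y} → Edge g x y → Edge g′ x y

module _ {l r k a₁ a₂ p e} {g₁ : Code l k a₁} {g₂ : Code (suc k) r a₂} {eq : e + p ≡ a₁} {Y : Vec Bool e}
         {k′ a₁′ a₂′ p′ e′} {g₁′ : Code l k′ a₁′} {g₂′ : Code (suc k′) r a₂′} {eq′ : e′ + p′ ≡ a₁′} {Y′ : Vec Bool e′}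
  where

  -- The left part of a code is connected, so it cannot reach across the gap
  -- that follows the left part of the other one.
  split-≮ : node g₁′ g₂′ eq′ Y′ ⊑ node g₁ g₂ eq Y → ¬ (k < k′)
  split-≮ sup k<k′ = true≢false (trans (sym (dec-true (l ≤? k) (Code-≤ g₁)))
      (trans (sym (Edge-connected g₁′ (On.isEquivalence χ isEquivalence) χ-const (Code-≤ g₁′) ≤-refl))
             (dec-false (k′ ≤? k) (<⇒≱ k<k′))))
    where
    true≢false : true ≢ false
    true≢false ()
    χ : ℕ → Bool
    χ x = does (x ≤? k)
    χ-const : ∀ {x y} → Edge g₁′ x y → χ x ≡ χ y
    χ-const {x} {y} E with ≤-<-connex x k | ≤-<-connex y k
    ... | inj₁ x≤k | inj₁ y≤k = trans (dec-true (x ≤? k) x≤k) (sym (dec-true (y ≤? k) y≤k))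
    ... | inj₂ k<x | inj₂ k<y = trans (dec-false (x ≤? k) (<⇒≱ k<x)) (sym (dec-false (y ≤? k) (<⇒≱ k<y)))
    ... | inj₂ k<x | inj₁ y≤k = contradiction (≤-trans (<⇒≤ (Edge-< E)) y≤k) (<⇒≱ k<x)
    ... | inj₁ x≤k | inj₂ k<y = contradiction (≤-trans (Edge-upper E) ≤-refl)
      (<⇒≱ (subst (k′ <_) (sym (crossing⇒end x≤k k<y (sup (inˡ E)))) (Code-≤ g₂′)))

module _ {l r k a₁ a₂} {g₁ : Code l k a₁} {g₂ : Code (suc k) r a₂}
         {p e} {eq : e + p ≡ a₁} {Y : Vec Bool e} {p′ e′} {eq′ : e′ + p′ ≡ a₁} {Y′ : Vec Bool e′} where

  spoke-⊑ : node g₁ g₂ eq Y ⊑ node g₁ g₂ eq′ Y′ → ∀ {j} → bit (true ∷ Y) j ≡ true →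
            ∃ λ j′ → bit (true ∷ Y′) j′ ≡ true × j + p ≡ j′ + p′
  spoke-⊑ sub {j} b with j′ , b′ , same ← spoke⁻¹ (vis-upper g₁ _) (Code-≤ g₂) (sub (spoke j b)) =
    j′ , b′ , vis-injective g₁ (spoke-bound Y eq b) (spoke-bound Y′ eq′ b′) same

  min-⊑ : node g₁ g₂ eq Y ⊑ node g₁ g₂ eq′ Y′ → p′ ≤ p
  min-⊑ sub with j′ , _ , p≡ ← spoke-⊑ sub {0} refl = subst (p′ ≤_) (sym p≡) (m≤n+m p′ j′)

bit-⊑ : ∀ {l r k a₁ a₂ p e} {g₁ : Code l k a₁} {g₂ : Code (suc k) r a₂} {eq eq′ : e + p ≡ a₁} {Y Y′ : Vec Bool e} →
        node g₁ g₂ eq Y ⊑ node g₁ g₂ eq′ Y′ → ∀ j → bit Y j ≡ true → bit Y′ j ≡ true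
bit-⊑ {p = p} sub j b with j′ , b′ , same ← spoke-⊑ sub {suc j} b
  with refl ← +-cancelʳ-≡ p _ j′ same = b′

true-ext : ∀ {b c : Bool} → (b ≡ true → c ≡ true) → (c ≡ true → b ≡ true) → b ≡ c
true-ext {true}  {c}     f _ = sym (f refl)
true-ext {false} {true}  _ h = h refl
true-ext {false} {false} _ _ = refl

-- The edges determine the cut `k`, then both parts as the edges on either side of it, then `p` as
-- the number of the first spoke, and finally the bits. The numbers of arches are only found equal
-- on the way, hence the equation between pairs.
Code-injective : ∀ {l r a a′} (g : Code l r a) (g′ : Code l r a′) → g ⊑ g′ → g′ ⊑ g →
                 _≡_ {A = ∃ (Code l r)} (a , g) (a′ , g′)
Code-injective leaf leaf _ _ = refl
Code-injective leaf (node g₁ g₂ _ _) _ _ = contradiction (≤-<-trans (Code-≤ g₁) (Code-≤ g₂)) (n≮n _)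
Code-injective (node g₁ g₂ _ _) leaf _ _ = contradiction (≤-<-trans (Code-≤ g₁) (Code-≤ g₂)) (n≮n _)
Code-injective (node {k = k} {p = p} g₁ g₂ eq Y) (node {k = k′} {p = p′} g₁′ g₂′ eq′ Y′) sub sup
  with refl ← ≤-antisym (≮⇒≥ (split-≮ sub)) (≮⇒≥ (split-≮ sup))
  with refl ← Code-injective g₁ g₁′ (λ E → inˡ⁻¹ (Edge-upper E) (sub (inˡ E))) (λ E → inˡ⁻¹ (Edge-upper E) (sup (inˡ E)))
     | refl ← Code-injective g₂ g₂′ (λ E → inʳ⁻¹ (Edge-lower E) (sub (inʳ E))) (λ E → inʳ⁻¹ (Edge-lower E) (sup (inʳ E)))
  with refl ← ≤-antisym (min-⊑ sup) (min-⊑ sub)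
  with refl ← +-cancelʳ-≡ p _ _ (trans eq (sym eq′))
  with refl ← ≡-irrelevant eq eq′
  with refl ← bit-ext Y Y′ (λ j → true-ext (bit-⊑ sub j) (bit-⊑ sup j)) = refl

-- Decomposition of connected plane graphs

bit-tabulate : ∀ {e} (f : ℕ → Bool) {j} → j < e → bit (tabulate {n = e} (f ∘ toℕ)) j ≡ f j
bit-tabulate {suc e} f {zero}  _         = refl
bit-tabulate {suc e} f {suc j} (s≤s j<e) = bit-tabulate (f ∘ suc) j<e

least : ∀ {P : ℕ → Set} → (∀ n → Dec (P n)) → ∀ n → P n →
        ∃ λ k → k ≤ n × P k × (∀ {j} → j < k → ¬ P j)
least P? zero    P0 = 0 , z≤n , P0 , λ ()
least P? (suc n) Pn with P? 0
... | yes P0 = 0 , z≤n , P0 , λ ()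
... | no ¬P0 with k , k≤n , Pk , k-min ← least (P? ∘ suc) n Pn =
  suc k , s≤s k≤n , Pk , λ { {zero} _ → ¬P0 ; {suc j} (s≤s j<k) → k-min j<k }

does-true : ∀ {A : Set} (A? : Dec A) → does A? ≡ true → A
does-true (yes a) _ = a

module Decompose (E : ℕ → ℕ → Set) (E? : ∀ x y → Dec (E x y)) (noncrossing : Noncrossing E) where

  Constant : ℕ → ℕ → (ℕ → Bool) → Set
  Constant l r χ = ∀ {x y} → l ≤ x → x < y → y ≤ r → E x y → χ x ≡ χ y

  -- Connectedness of the subgraph induced on l, …, r, in terms of 2-colourings.
  Uncut : ℕ → ℕ → Set
  Uncut l r = ∀ χ → Constant l r χ → ∀ {x} → l ≤ x → x ≤ r → χ x ≡ χ l

  -- An edge over the gap after `k` that does not end at `r`. The strict upper bounds suit a bounded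
  -- search.
  Bridged : ℕ → ℕ → ℕ → Set
  Bridged l r k = ∃ λ x → x < suc k × l ≤ x × ∃ λ y → y < r × k < y × E x y

  bridged? : ∀ l r k → Dec (Bridged l r k)
  bridged? l r k = anyUpTo? (λ x → l ≤? x ×-dec anyUpTo? (λ y → k <? y ×-dec E? x y) r) (suc k)

  module _ {l r k : ℕ} (l≤k : l ≤ k) (k<r : k < r) (unbridged : ¬ Bridged l r k) where

    over-end : ∀ {x y} → l ≤ x → x ≤ k → k < y → y ≤ r → E x y → y ≡ r
    over-end l≤x x≤k k<y y≤r e with m≤n⇒m<n∨m≡n y≤r
    ... | inj₁ y<r = contradiction (_ , s≤s x≤k , l≤x , _ , y<r , k<y , e) unbridged
    ... | inj₂ y≡r = y≡r

    piecewise : (ℕ → Bool) → (ℕ → Bool) → ℕ → Bool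
    piecewise χ χ′ x = if does (x ≤? k) then χ x else χ′ x

    piecewise-≤ : ∀ χ χ′ {x} → x ≤ k → piecewise χ χ′ x ≡ χ x
    piecewise-≤ χ χ′ {x} x≤k rewrite dec-true (x ≤? k) x≤k = refl

    piecewise-> : ∀ χ χ′ {x} → k < x → piecewise χ χ′ x ≡ χ′ x
    piecewise-> χ χ′ {x} k<x rewrite dec-false (x ≤? k) (<⇒≱ k<x) = refl

    piecewise-constant : ∀ χ χ′ → Constant l k χ → Constant (suc k) r χ′ →
                         (∀ {x} → l ≤ x → x ≤ k → E x r → χ x ≡ χ′ r) → Constant l r (piecewise χ χ′)
    piecewise-constant χ χ′ const const′ link {x} {y} l≤x x<y y≤r e with ≤-<-connex x k | ≤-<-connex y k
    ... | inj₁ x≤k | inj₁ y≤k = trans (piecewise-≤ χ χ′ x≤k) (trans (const l≤x x<y y≤k e) (sym (piecewise-≤ χ χ′ y≤k)))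
    ... | inj₂ k<x | inj₂ k<y = trans (piecewise-> χ χ′ k<x) (trans (const′ k<x x<y y≤r e) (sym (piecewise-> χ χ′ k<y)))
    ... | inj₂ k<x | inj₁ y≤k = contradiction (≤-trans (<⇒≤ x<y) y≤k) (<⇒≱ k<x)
    ... | inj₁ x≤k | inj₂ k<y with refl ← over-end l≤x x≤k k<y y≤r e =
      trans (piecewise-≤ χ χ′ x≤k) (trans (link l≤x x≤k e) (sym (piecewise-> χ χ′ k<y)))

    -- Edges between the two sides all end at `r`, so a colouring of the right side extends to the
    -- left side by the constant colour of `r`.
    uncutʳ : Uncut l r → Uncut (suc k) r
    uncutʳ uncut χ const = λ k<x x≤r → trans (to-end k<x x≤r) (sym (to-end ≤-refl k<r))
      where
      to-end : ∀ {x} → k < x → x ≤ r → χ x ≡ χ r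
      to-end k<x x≤r = trans (sym (piecewise-> (λ _ → χ r) χ k<x))
        (trans (uncut _ (piecewise-constant (λ _ → χ r) χ (λ _ _ _ _ → refl) const (λ _ _ _ → refl))
                      (≤-trans l≤k (<⇒≤ k<x)) x≤r)
               (piecewise-≤ (λ _ → χ r) χ l≤k))

    joined : Uncut l r → ¬ (∀ {x} → l ≤ x → x ≤ k → ¬ E x r)
    joined uncut none = case trans (sym (piecewise-> (λ _ → true) (λ _ → false) k<r))
        (trans (uncut _ (piecewise-constant (λ _ → true) (λ _ → false) (λ _ _ _ _ → refl) (λ _ _ _ _ → refl)
                          (λ l≤x x≤k e → contradiction e (none l≤x x≤k)))
                        (≤-trans l≤k (<⇒≤ k<r)) ≤-refl)
               (piecewise-≤ (λ _ → true) (λ _ → false) l≤k)) of λ ()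

    Covered : ℕ → Set
    Covered x = ∃ λ u → ∃ λ v → l ≤ u × u < x × x < v × v ≤ k × E u v

    spoke-uncovered : ∀ {x} → E x r → ¬ Covered x
    spoke-uncovered e (u , v , _ , u<x , x<v , v≤k , e′) = noncrossing u<x x<v (≤-<-trans v≤k k<r) e′ e

    module _ (bridged : ∀ {j} → l ≤ j → j < k → Bridged l r j) where

      -- The leftmost neighbour of an uncovered vertex is again uncovered.
      uncovered-constant : ∀ χ → Constant l k χ → ∀ n {x} → x < n → l ≤ x → x ≤ k → ¬ Covered x → χ x ≡ χ l
      uncovered-constant χ const (suc n) {x} (s≤s x≤n) l≤x x≤k exposed with m≤n⇒m<n∨m≡n l≤x
      ... | inj₂ refl = refl
      uncovered-constant χ const (suc n) {suc x} (s≤s x<n) l≤x x<k exposed | inj₁ (s≤s l≤x′)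
        -- The gap just before the vertex `suc x` is bridged by some edge uv with v < r. As the gap
        -- after `k` is not bridged, v ≤ k, and as `suc x` is uncovered, v can only be `suc x`: so
        -- `suc x` has a neighbour to its left.
        with u , s≤s u≤x , l≤u , v , v<r , x<v , e ← bridged l≤x′ x<k
        with ≤-<-connex v k
      ... | inj₂ k<v = contradiction (u , s≤s (≤-trans u≤x (<⇒≤ x<k)) , l≤u , v , v<r , k<v , e) unbridged
      ... | inj₁ v≤k with m≤n⇒m<n∨m≡n x<v
      ...   | inj₁ sx<v = contradiction (u , v , l≤u , s≤s u≤x , sx<v , v≤k , e) exposed
      ...   | inj₂ refl with w , w≤u , (l≤w , e′) , w-min ← least (λ w → l ≤? w ×-dec E? w (suc x)) u (l≤u , e) =
        trans (sym (const l≤w (s≤s (≤-trans w≤u u≤x)) v≤k e′))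
          (uncovered-constant χ const n (≤-<-trans (≤-trans w≤u u≤x) x<n) l≤w (≤-trans (≤-trans w≤u u≤x) (<⇒≤ x<k)) w-open)
        where
        w-open : ¬ Covered w
        w-open (a , b , l≤a , a<w , w<b , b≤k , f) with <-cmp b (suc x)
        ... | tri< b<x _ _    = noncrossing a<w w<b b<x f e′
        ... | tri≈ _ refl _   = w-min a<w (l≤a , f)
        ... | tri> _ _ x<b    = exposed (a , b , l≤a , <-trans a<w (s≤s (≤-trans w≤u u≤x)) , x<b , b≤k , f)

      -- To extend a colouring of the left side, all neighbours of `r` there must have one colour.
      -- By planarity they are uncovered, and `uncovered-constant` gives them the colour of `l`.
      uncutˡ : Uncut l r → Uncut l k
      uncutˡ uncut χ const {x} l≤x x≤k = trans (sym (piecewise-≤ χ (λ _ → χ l) x≤k))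
        (trans (uncut _ (piecewise-constant χ (λ _ → χ l) const (λ _ _ _ _ → refl)
                          (λ l≤x x≤k e → uncovered-constant χ const _ ≤-refl l≤x x≤k (spoke-uncovered e)))
                        l≤x (≤-trans x≤k (<⇒≤ k<r)))
               (piecewise-≤ χ (λ _ → χ l) l≤k))

  Represents : ∀ {l r a} → Code l r a → Set
  Represents {l} {r} g = (∀ {x y} → Edge g x y → E x y) ×
                         (∀ {x y} → l ≤ x → x < y → y ≤ r → E x y → Edge g x y)

  spoke-vis : ∀ {l k r a} (g : Code l k a) → Represents g → k < r → ¬ Bridged l r k →
              ∀ {x} → l ≤ x → x ≤ k → E x r → ∃ λ j → j ≤ a × x ≡ vis g j
  spoke-vis g rep k<r unbridged l≤x x≤k e = vis-complete g l≤x x≤k λ { (u , v , u<x , x<v , f) →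
    spoke-uncovered (Code-≤ g) k<r unbridged e (u , v , Edge-lower f , u<x , x<v , Edge-upper f , proj₁ rep f) }

  module Node {l k r a₁ a₂} (g₁ : Code l k a₁) (g₂ : Code (suc k) r a₂)
              (rep₁ : Represents g₁) (rep₂ : Represents g₂)
              (unbridged : ¬ Bridged l r k) {p : ℕ} (p≤a₁ : p ≤ a₁) (first : E (vis g₁ p) r)
              (p-min : ∀ {j} → j < p → ¬ E (vis g₁ j) r) where

    -- The offset is `suc j + p` because the spoke from vertex number `p` is implicit in a node.
    selected : ℕ → Bool
    selected j = does (E? (vis g₁ (suc j + p)) r)

    Y : Vec Bool (a₁ ∸ p)
    Y = tabulate (selected ∘ toℕ)

    code : Code l r (suc p)
    code = node g₁ g₂ (m∸n+n≡m p≤a₁) Y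

    sound : ∀ {x y} → Edge code x y → E x y
    sound (inˡ f)           = proj₁ rep₁ f
    sound (inʳ f)           = proj₁ rep₂ f
    sound (spoke zero _)    = first
    sound (spoke (suc j) b) = does-true (E? _ r) (trans (sym (bit-tabulate selected (bit-< Y j b))) b)

    spoke-edge : ∀ j → j + p ≤ a₁ → E (vis g₁ (j + p)) r → Edge code (vis g₁ (j + p)) r
    spoke-edge zero    _   _ = spoke 0 refl
    spoke-edge (suc j) j<a e = spoke (suc j)
      (trans (bit-tabulate selected (m+n≤o⇒m≤o∸n (suc j) j<a)) (dec-true (E? _ r) e))

    complete : ∀ {x y} → l ≤ x → x < y → y ≤ r → E x y → Edge code x y
    complete {x} {y} l≤x x<y y≤r e with ≤-<-connex x k | ≤-<-connex y k
    ... | inj₁ x≤k | inj₁ y≤k = inˡ (proj₂ rep₁ l≤x x<y y≤k e)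
    ... | inj₂ k<x | inj₂ k<y = inʳ (proj₂ rep₂ k<x x<y y≤r e)
    ... | inj₂ k<x | inj₁ y≤k = contradiction (≤-trans (<⇒≤ x<y) y≤k) (<⇒≱ k<x)
    ... | inj₁ x≤k | inj₂ k<y
      with refl ← over-end (Code-≤ g₁) (Code-≤ g₂) unbridged l≤x x≤k k<y y≤r e
      with j , j≤a₁ , refl ← spoke-vis g₁ rep₁ (Code-≤ g₂) unbridged l≤x x≤k e =
      subst (λ j → Edge code (vis g₁ j) r) j≡ (spoke-edge (j ∸ p) (subst (_≤ a₁) (sym j≡) j≤a₁)
        (subst (λ j → E (vis g₁ j) r) (sym j≡) e))
      where
      j≡ : j ∸ p + p ≡ j
      j≡ = m∸n+n≡m (≮⇒≥ λ j<p → p-min j<p e)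

  -- `n` bounds the length r - l, which drops for both parts: the first loses `r`, the second loses
  -- `l`.
  decompose : ∀ n {l r} → r ≤ n + l → l ≤ r → Uncut l r → ∃ λ a → Σ (Code l r a) Represents
  decompose n {l} {r} r≤ l≤r uncut with m≤n⇒m<n∨m≡n l≤r
  ... | inj₂ refl = 0 , leaf , (λ ()) , λ l≤x x<y y≤l → contradiction (≤-trans y≤l l≤x) (<⇒≱ x<y)
  decompose zero    r≤ _ _ | inj₁ l<r = contradiction r≤ (<⇒≱ l<r)
  decompose (suc n) {l} {suc r} r≤ _ uncut | inj₁ (s≤s l≤r)
    -- The last point is `suc r` here. The search succeeds at `r` at the latest, as no vertex lies
    -- strictly between `r` and `suc r`.
    with k , k≤r , (l≤k , unbridged) , k-min ← least (λ k → l ≤? k ×-dec ¬? (bridged? l (suc r) k)) r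
           (l≤r , λ { (_ , _ , _ , _ , y<r , r<y , _) → <⇒≱ r<y (s≤s⁻¹ y<r) })
    with a₁ , g₁ , rep₁ ← decompose n {l} {k} (≤-trans k≤r (s≤s⁻¹ r≤)) l≤k
           (uncutˡ l≤k (s≤s k≤r) unbridged
             (λ {j} l≤j j<k → decidable-stable (bridged? l (suc r) j) (λ unb → k-min j<k (l≤j , unb))) uncut)
       | a₂ , g₂ , rep₂ ← decompose n {suc k} {suc r}
           (≤-trans r≤ (≤-trans (s≤s (+-monoʳ-≤ n l≤k)) (≤-reflexive (sym (+-suc n k))))) (s≤s k≤r)
           (uncutʳ l≤k (s≤s k≤r) unbridged uncut)
    with anyUpTo? (λ j → E? (vis g₁ j) (suc r)) (suc a₁)
  ... | no none = ⊥-elim (joined l≤k (s≤s k≤r) unbridged uncut λ l≤x x≤k e →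
    case spoke-vis g₁ rep₁ (s≤s k≤r) unbridged l≤x x≤k e of λ { (j , j≤a₁ , refl) → none (j , s≤s j≤a₁ , e) })
  ... | yes (j , s≤s j≤a₁ , e) with p , p≤j , first , p-min ← least (λ j → E? (vis g₁ j) (suc r)) j e =
    suc p , Node.code g₁ g₂ rep₁ rep₂ unbridged (≤-trans p≤j j≤a₁) first p-min
          , Node.sound g₁ g₂ rep₁ rep₂ unbridged (≤-trans p≤j j≤a₁) first p-min
          , Node.complete g₁ g₂ rep₁ rep₂ unbridged (≤-trans p≤j j≤a₁) first p-min

-- Graphs and codes

Count-intro : ∀ {a ℓ p} (S : Setoid a ℓ) (P : Setoid.Carrier S → Set p) {k}
              (f : Fin k → Setoid.Carrier S) → (∀ i → P (f i)) →
              (∀ {i j} → Setoid._≈_ S (f i) (f j) → i ≡ j) →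
              (∀ x → P x → ∃ λ i → Setoid._≈_ S (f i) x) → Count S P k
Count-intro S P f Pf f-inj f-surj = record
  { to        = λ i → f i , Pf i
  ; from      = index
  ; to-cong   = λ { refl → S.refl }
  ; from-cong = λ {x} {y} x≈y → f-inj (S.trans (hit x) (S.trans x≈y (S.sym (hit y))))
  ; inverse   = (λ { {x} refl → hit x }) , λ {i} {x} x≈fi → f-inj (S.trans (hit x) x≈fi)
  }
  where
  module S = Setoid S
  index = λ (x : ∃ P) → proj₁ (f-surj (proj₁ x) (proj₂ x))
  hit : ∀ x → f (index x) S.≈ proj₁ x
  hit (x , Px) = proj₂ (f-surj x Px)

Count-map : ∀ {a ℓ p q} (S : Setoid a ℓ) {P : Setoid.Carrier S → Set p} {Q : Setoid.Carrier S → Set q} {k} →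
            (∀ {x} → P x → Q x) → (∀ {x} → Q x → P x) → Count S P k → Count S Q k
Count-map S P⇒Q Q⇒P count = record
  { to        = λ i → map₂ P⇒Q (to i)
  ; from      = λ x → from (map₂ Q⇒P x)
  ; to-cong   = λ { refl → Setoid.refl S }
  ; from-cong = from-cong
  ; inverse   = (λ eq → inverseˡ eq) , (λ eq → inverseʳ eq)
  }
  where open Inverse count

module _ {m a} (g : Code 0 m a) where

  joined? : ∀ x y → Dec (Edge g x y ⊎ Edge g y x)
  joined? x y = Edge? g x y ⊎-dec Edge? g y x

  toGraph : Graph (suc m)
  toGraph .adj u v    = does (joined? (toℕ u) (toℕ v))
  toGraph .irrefl u   = dec-false (joined? (toℕ u) (toℕ u)) λ e → n≮n _ (Sum.reduce (Sum.map Edge-< Edge-< e))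
  toGraph .symm u v   = Bool.∨-comm (does (Edge? g (toℕ u) (toℕ v))) _

  Adj⇒Edge : ∀ {u v} → u Fin.< v → Adj toGraph u v → Edge g (toℕ u) (toℕ v)
  Adj⇒Edge {u} {v} u<v uv with does-true (joined? (toℕ u) (toℕ v)) uv
  ... | inj₁ e = e
  ... | inj₂ e = contradiction (Edge-< e) (<-asym u<v)

  Edge⇒Adj : ∀ {u v} → Edge g (toℕ u) (toℕ v) → Adj toGraph u v
  Edge⇒Adj {u} {v} e = dec-true (joined? (toℕ u) (toℕ v)) (inj₁ e)

  -- Defined on all of ℕ so that path equivalence can be pulled back along it and handed to
  -- `Edge-connected`.
  clamp : ℕ → Fin (suc m)
  clamp x = fromℕ< (s≤s (m⊓n≤n x m))

  toℕ-clamp : ∀ {x} → x ≤ m → toℕ (clamp x) ≡ x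
  toℕ-clamp {x} x≤m = trans (Fin.toℕ-fromℕ< _) (m≤n⇒m⊓n≡m x≤m)

  clamp-toℕ : ∀ u → clamp (toℕ u) ≡ u
  clamp-toℕ u = Fin.toℕ-injective (toℕ-clamp (s≤s⁻¹ (Fin.toℕ<n u)))

  toGraph-noncrossing : NoncrossingGraph toGraph
  toGraph-noncrossing a<b b<c c<d ac bd =
    Edge-noncrossing g a<b b<c c<d (Adj⇒Edge (<-trans a<b b<c) ac) (Adj⇒Edge (<-trans b<c c<d) bd)

  toGraph-connected : Connected toGraph
  toGraph-connected u v = to-zero u ◅◅ reverse flip (to-zero v)
    where
    flip : ∀ {u v} → Adj toGraph u v → Adj toGraph v u
    flip {u} {v} uv = trans (symm toGraph v u) uv
    star-equivalence : IsEquivalence (Star (Adj toGraph))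
    star-equivalence = record { refl = ε ; sym = reverse flip ; trans = _◅◅_ }
    edge-star : ∀ {x y} → Edge g x y → Star (Adj toGraph) (clamp x) (clamp y)
    edge-star {x} {y} e = Edge⇒Adj (subst₂ (Edge g)
      (sym (toℕ-clamp (≤-trans (<⇒≤ (Edge-< e)) (Edge-upper e)))) (sym (toℕ-clamp (Edge-upper e))) e) ◅ ε
    to-zero : ∀ u → Star (Adj toGraph) u (clamp 0)
    to-zero u = subst (λ w → Star (Adj toGraph) w (clamp 0)) (clamp-toℕ u)
      (Edge-connected g (On.isEquivalence clamp star-equivalence) edge-star z≤n (s≤s⁻¹ (Fin.toℕ<n u)))

  toGraph-unhidden : Count (setoid (Fin (suc m))) (UnhiddenVertex toGraph) (suc a)
  toGraph-unhidden = Count-intro (setoid (Fin (suc m))) _ f unhidden f-injective f-surjective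
    where
    f : Fin (suc a) → Fin (suc m)
    f j = clamp (vis g (toℕ j))
    toℕ-f : ∀ j → toℕ (f j) ≡ vis g (toℕ j)
    toℕ-f j = toℕ-clamp (vis-upper g (toℕ j))
    unhidden : ∀ j → UnhiddenVertex toGraph (f j)
    unhidden j {u} {v} u<f f<v uv = vis-visible g (toℕ j)
      (toℕ u , toℕ v , subst (toℕ u <_) (toℕ-f j) u<f , subst (_< toℕ v) (toℕ-f j) f<v , Adj⇒Edge (<-trans u<f f<v) uv)
    f-injective : ∀ {i j} → f i ≡ f j → i ≡ j
    f-injective {i} {j} eq = Fin.toℕ-injective (vis-injective g (s≤s⁻¹ (Fin.toℕ<n i)) (s≤s⁻¹ (Fin.toℕ<n j))
      (trans (sym (toℕ-f i)) (trans (cong toℕ eq) (toℕ-f j))))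
    f-surjective : ∀ u → UnhiddenVertex toGraph u → ∃ λ j → f j ≡ u
    f-surjective u unh
      with j , j≤a , u≡ ← vis-complete g {toℕ u} z≤n (s≤s⁻¹ (Fin.toℕ<n u))
        (λ { (x , y , x<u , u<y , e) → unh
               (subst (_< toℕ u) (sym (toℕ-clamp (≤-trans (<⇒≤ (Edge-< e)) (Edge-upper e)))) x<u)
               (subst (toℕ u <_) (sym (toℕ-clamp (Edge-upper e))) u<y)
               (Edge⇒Adj (subst₂ (Edge g) (sym (toℕ-clamp (≤-trans (<⇒≤ (Edge-< e)) (Edge-upper e))))
                                          (sym (toℕ-clamp (Edge-upper e))) e)) }) =
      fromℕ< (s≤s j≤a) , Fin.toℕ-injective (trans (toℕ-f _) (trans (cong (vis g) (Fin.toℕ-fromℕ< _)) (sym u≡)))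

toGraph-⊑ : ∀ {m a a′} (g : Code 0 m a) (g′ : Code 0 m a′) → (∀ u v → adj (toGraph g) u v ≡ adj (toGraph g′) u v) → g ⊑ g′
toGraph-⊑ g g′ G≈G′ {x} {y} e = subst₂ (Edge g′) toℕx toℕy
  (Adj⇒Edge g′ {u} {v} (subst₂ _<_ (sym toℕx) (sym toℕy) (Edge-< e))
    (trans (sym (G≈G′ u v)) (Edge⇒Adj g (subst₂ (Edge g) (sym toℕx) (sym toℕy) e))))
  where
  u = clamp g x
  v = clamp g y
  toℕx = toℕ-clamp g (≤-trans (<⇒≤ (Edge-< e)) (Edge-upper e))
  toℕy = toℕ-clamp g (Edge-upper e)

toGraph-injective : ∀ {m a} {g g′ : Code 0 m a} → (∀ u v → adj (toGraph g) u v ≡ adj (toGraph g′) u v) → g ≡ g′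
toGraph-injective {g = g} {g′} G≈G′
  with refl ← Code-injective g g′ (toGraph-⊑ g g′ G≈G′) (toGraph-⊑ g′ g (λ u v → sym (G≈G′ u v))) = refl

toGraph-surjective : ∀ {m} (G : Graph (suc m)) → NoncrossingGraph G → Connected G →
                     ∃ λ a → Σ (Code 0 m a) λ g → ∀ u v → adj (toGraph g) u v ≡ adj G u v
toGraph-surjective {m} G nc conn = conclude (decompose m (≤-reflexive (sym (+-identityʳ m))) z≤n uncut)
  where
  E : ℕ → ℕ → Set
  E x y = ∃ λ u → ∃ λ v → toℕ u ≡ x × toℕ v ≡ y × Adj G u v
  E? : ∀ x y → Dec (E x y)
  E? x y = Fin.any? λ u → Fin.any? λ v → toℕ u ≟ x ×-dec toℕ v ≟ y ×-dec adj G u v Bool.≟ true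
  E-noncrossing : Noncrossing E
  E-noncrossing a<b b<c c<d (_ , _ , refl , refl , ac) (_ , _ , refl , refl , bd) = nc a<b b<c c<d ac bd
  open Decompose E E? E-noncrossing

  uncut : Uncut 0 m
  uncut χ const {x} _ x≤m = trans (cong χ (sym (Fin.toℕ-fromℕ< (s≤s x≤m)))) (along (conn (fromℕ< (s≤s x≤m)) zero))
    where
    adjacent : ∀ {u v} → Adj G u v → Tri (toℕ u < toℕ v) (toℕ u ≡ toℕ v) (toℕ v < toℕ u) → χ (toℕ u) ≡ χ (toℕ v)
    adjacent {u} {v} uv (tri< u<v _ _) = const z≤n u<v (s≤s⁻¹ (Fin.toℕ<n v)) (u , v , refl , refl , uv)
    adjacent {u} {v} uv (tri≈ _ u≡v _) = cong χ u≡v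
    adjacent {u} {v} uv (tri> _ _ v<u) =
      sym (const z≤n v<u (s≤s⁻¹ (Fin.toℕ<n u)) (v , u , refl , refl , trans (symm G v u) uv))
    along : ∀ {u v} → Star (Adj G) u v → χ (toℕ u) ≡ χ (toℕ v)
    along ε          = refl
    along (uv ◅ vws) = trans (adjacent uv (<-cmp _ _)) (along vws)

  conclude : (∃ λ a → Σ (Code 0 m a) Represents) → ∃ λ a → Σ (Code 0 m a) λ g → ∀ u v → adj (toGraph g) u v ≡ adj G u v
  conclude (a , g , sound , complete) = a , g , λ u v → true-ext (back u v) (forth u v (<-cmp (toℕ u) (toℕ v)))
    where
    E⇒Adj : ∀ {u v} → E (toℕ u) (toℕ v) → Adj G u v
    E⇒Adj (u , v , p , q , uv) = subst₂ (Adj G) (Fin.toℕ-injective p) (Fin.toℕ-injective q) uv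
    back : ∀ u v → Adj (toGraph g) u v → Adj G u v
    back u v uv with does-true (joined? g (toℕ u) (toℕ v)) uv
    ... | inj₁ e = E⇒Adj (sound e)
    ... | inj₂ e = trans (symm G u v) (E⇒Adj (sound e))
    forth : ∀ u v → Tri (toℕ u < toℕ v) (toℕ u ≡ toℕ v) (toℕ v < toℕ u) → Adj G u v → Adj (toGraph g) u v
    forth u v (tri< u<v _ _) uv = Edge⇒Adj g (complete z≤n u<v (s≤s⁻¹ (Fin.toℕ<n v)) (u , v , refl , refl , uv))
    forth u v (tri≈ _ u≡v _) uv with refl ← Fin.toℕ-injective u≡v = contradiction (trans (sym uv) (irrefl G u)) λ ()
    forth u v (tri> _ _ v<u) uv = trans (symm (toGraph g) u v)
      (Edge⇒Adj g (complete z≤n v<u (s≤s⁻¹ (Fin.toℕ<n u)) (v , u , refl , refl , trans (symm G v u) uv)))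

-- Degree vectors of points in convex position

module _ {c ℓ₁ ℓ₂} (F : OrderedField c ℓ₁ ℓ₂) where
  open Geometry F
  open Orientation F

  -- Visibility degree q means q + 2 visible vertices, hence q + 1 arches; and `i` points are
  -- numbered 0, ..., i - 1.
  degreeVector : ℕ → ∀ {n} → Vector ℕ n
  degreeVector i q = total (i ∸ 1) (δ (suc (toℕ q)))

  isDegreeVector : ∀ {m n} (P : ConvexPoints (suc (suc m))) → IsDegreeVector P (degreeVector (suc m) {n})
  isDegreeVector {m} (pt , convex) j =
    Count-intro (graphSetoid (suc m)) Counted (toGraph ∘ code) (λ k → counted (code k)) injective surjective
    where
    open Extended pt convex
    open Convex old old-convex using (noncrossing⇒Plane; Plane⇒noncrossing)
    Counted : Graph (suc m) → Set _
    Counted G = Plane old G × Connected G × VisibilityDegree pt G (toℕ j)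
    codes = Fin-Code-↔ m (suc (toℕ j))
    code = Inverse.to codes
    counted : (g : Code 0 m (suc (toℕ j))) → Counted (toGraph g)
    counted g = noncrossing⇒Plane {toGraph g} (toGraph-noncrossing g) , toGraph-connected g ,
      Count-map (setoid (Fin (suc m))) (unhidden⇒Visible {toGraph g}) (Visible⇒unhidden {toGraph g}) (toGraph-unhidden g)
    injective : ∀ {k k′} → (∀ u v → adj (toGraph (code k)) u v ≡ adj (toGraph (code k′)) u v) → k ≡ k′
    injective {k} {k′} eq = trans (sym (Inverse.strictlyInverseʳ codes k))
      (trans (cong (Inverse.from codes) (toGraph-injective eq)) (Inverse.strictlyInverseʳ codes k′))
    surjective : ∀ G → Counted G → ∃ λ k → ∀ u v → adj (toGraph (code k)) u v ≡ adj G u v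
    surjective G (plane , connected , visible) = locate (toGraph-surjective G (Plane⇒noncrossing {G} plane) connected)
      where
      -- Decomposing `G` gives a code with an unknown number of arches. It is fixed by counting the
      -- visible vertices twice, once from the code and once from the visibility degree.
      arches : ∀ {a} (g : Code 0 m a) → (∀ u v → adj (toGraph g) u v ≡ adj G u v) → a ≡ suc (toℕ j)
      arches g g≈G = suc-injective (Count-unique (setoid (Fin (suc m))) (UnhiddenVertex (toGraph g))
        (toGraph-unhidden g)
        (Count-map (setoid (Fin (suc m))) {P = λ u → Visible old G (pt (fromℕ (suc m))) (old u)}
          (λ {u} visible {a} {b} a<u u<b ab → Visible⇒unhidden {G} {u} visible a<u u<b (trans (sym (g≈G a b)) ab))
          (λ {u} unhidden → unhidden⇒Visible {G} {u} (λ {a} {b} a<u u<b ab → unhidden a<u u<b (trans (g≈G a b) ab)))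
          visible))
      index : ∀ {a} (g : Code 0 m a) → (∀ u v → adj (toGraph g) u v ≡ adj G u v) → a ≡ suc (toℕ j) →
              ∃ λ k → ∀ u v → adj (toGraph (code k)) u v ≡ adj G u v
      index g g≈G refl = Inverse.from codes g , λ u v →
        trans (cong (λ g → adj (toGraph g) u v) (Inverse.strictlyInverseˡ codes g)) (g≈G u v)
      locate : (∃ λ a → Σ (Code 0 m a) λ g → ∀ u v → adj (toGraph g) u v ≡ adj G u v) →
               ∃ λ k → ∀ u v → adj (toGraph (code k)) u v ≡ adj G u v
      locate (a , g , g≈G) = index g g≈G (arches g g≈G)

theorem11 : ∀ {c ℓ₁ ℓ₂} (F : OrderedField c ℓ₁ ℓ₂) → let open Geometry F in
    (n : ℕ) → 2 ≤ n →
    (P : ∀ i → ConvexPoints (suc i)) →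
    ∃ λ (v : ℕ → Vector ℕ n) →
    (∀ i → 2 ≤ i → i ≤ suc n → IsDegreeVector (P i) (v i)) ×
    (∀ i → 2 ≤ i → i ≤ n → v (suc i) ≗ C n *ᵥ v i)
theorem11 F n _ P = (λ i → degreeVector F i) ,
  (λ { (suc m) (s≤s _) _ → isDegreeVector F (P (suc m)) }) ,
  (λ { (suc (suc m)) (s≤s (s≤s _)) i≤n r → total-recurrence m n (<⇒≤ i≤n) r })
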